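{- Let $>$ be a reduction order and let $\Gamma\colon(\mathcal{E}_0,\mathcal{R}_0)\vdash_{\mathsf l}(\mathcal{E}_1,\mathcal{R}_1)\vdash_{\mathsf l}(\mathcal{E}_2,\mathcal{R}_2)\vdash_{\mathsf l}\cdots$ be an infinite run of linear ordered completion $\mathsf{KB_l}$ with respect to $>$, with $\mathcal{R}_0=\varnothing$ and $\mathcal{E}_0$ linear. If $\Gamma$ is fair and $\mathcal{E}_\omega=\varnothing$ then $\mathcal{R}_\omega$ is a complete presentation of $\mathcal{E}_0$.
   Context: Terms are built from a signature $\mathcal{F}$ and an infinite set of variables. An ES is a set of pairs of terms $s\approx t$; a TRS is a set of pairs $\ell\to r$ with $\ell$ not a variable and every variable of $r$ occurring in $\ell$. An equation or rule is linear if no variable occurs more than once in its left-hand side and no variable occurs more than once in its right-hand side; a set is linear if all its elements are. For a set $X$ of pairs of terms, $X^{\pm}=X\cup X^{ -1}$, $\to_X$ is the closure of $X$ under contexts and substitutions, $\leftrightarrow_X$ its symmetric closure, $\leftrightarrow_X^*$ the conversion relation, and $\downarrow_X\,=\,\to_X^*\cdot{}_X^*{\leftarrow}$ joinability. A reduction order is a well-founded strict order on terms closed under contexts and substitutions. A TRS is complete if it is terminating and confluent; $\mathcal{R}$ is a complete presentation of $\mathcal{E}$ if $\mathcal{R}$ is complete and $\leftrightarrow_{\mathcal{R}}^*\,=\,\leftrightarrow_{\mathcal{E}}^*$. A term $s$ encompasses $t$ if $s=C[t\sigma]$ for some $C,\sigma$; properly, if moreover $t$ does not encompass $s$. Inference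 system $\mathsf{KB_l}$ ($\uplus$ is disjoint union): $(\mathcal{E},\mathcal{R})\vdash_{\mathsf l}(\mathcal{E}',\mathcal{R}')$ if it is an instance of one of - deduce: $(\mathcal{E},\mathcal{R})\vdash(\mathcal{E}\cup\{s\approx t\},\mathcal{R})$ if $s\,{}_{\mathcal{E}^\pm\cup\mathcal{R}}{\leftarrow}\cdot\to_{\mathcal{E}^\pm\cup\mathcal{R}}t$ and $s\approx t$ is linear; - orient: $(\mathcal{E}\uplus\{s\approx t\},\mathcal{R})\vdash(\mathcal{E},\mathcal{R}\cup\{s\to t\})$ if $s>t$, and $(\mathcal{E}\uplus\{s\approx t\},\mathcal{R})\vdash(\mathcal{E},\mathcal{R}\cup\{t\to s\})$ if $t>s$; - delete: $(\mathcal{E}\uplus\{s\approx s\},\mathcal{R})\vdash(\mathcal{E},\mathcal{R})$; - compose: $(\mathcal{E},\mathcal{R}\uplus\{s\to t\})\vdash(\mathcal{E},\mathcal{R}\cup\{s\to u\})$ if $t\to_{\mathcal{R}}u$; - simplify: $(\mathcal{E}\uplus\{s\approx t\},\mathcal{R})\vdash(\mathcal{E}\cup\{u\approx t\},\mathcal{R})$ if $s\to_{\mathcal{R}}u$, and $(\mathcal{E}\uplus\{s\approx t\},\mathcal{R})\vdash(\mathcal{E}\cup\{s\approx u\},\mathcal{R})$ if $t\to_{\mathcal{R}}u$; - collapse: $(\mathcal{E},\mathcal{R}\uplus\{t\to s\})\vdash(\mathcal{E}\cup\{u\approx s\},\mathcal{R})$ if $t\to u$ using some rule $\ell\to r\in\mathcal{R}$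 such that $t$ properly encompasses $\ell$. For an infinite run put $\mathcal{E}_\infty=\bigcup_{i}\mathcal{E}_i$, $\mathcal{E}_\omega=\bigcup_{i}\bigcap_{j\ge i}\mathcal{E}_j$, $\mathcal{R}_\omega=\bigcup_{i}\bigcap_{j\ge i}\mathcal{R}_j$. Linear critical pairs: an extended overlap of an ES $\mathcal{E}$ is a triple $\langle\ell_1\approx r_1,p,\ell_2\approx r_2\rangle$ where both equations are variants (up to renaming) of equations in $\mathcal{E}^\pm$ without common variables, $p$ is a non-variable position of $\ell_2$, $\ell_1$ and $\ell_2|_p$ are unifiable with mgu $\mu$, $r_1\mu\not>\ell_1\mu$ and $r_2\mu\not>\ell_2\mu$; it gives the extended critical pair $\ell_2[r_1]_p\mu\approx r_2\mu$. If moreover ($\ell_1>r_1$ and $r_2\not>\ell_2$) or ($\ell_2>r_2$ and $r_1\not>\ell_1$), this is a linear critical pair. $\mathrm{LCP}_>(\mathcal{E})$ is the set of linear critical pairs of $\mathcal{E}$ (rules are viewed as equations in $\mathcal{E}_\omega\cup\mathcal{R}_\omega$). The run is fair if $\mathrm{LCP}_>(\mathcal{E}_\omega\cup\mathcal{R}_\omega)\subseteq{\downarrow_{\mathcal{R}_\omega}}\cup{\leftrightarrow_{\mathcal{E}_\infty}}$. -}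

module Defs where

open import Level using (0ℓ) renaming (suc to lsuc)
open import Data.Nat.Base using (ℕ; suc; _≤_)
open import Data.Fin.Base using (Fin)
open import Data.Vec.Base using (Vec; []; _∷_; lookup; _[_]≔_)
open import Data.List.Base using (List; []; _∷_; _++_)
open import Data.List.Membership.Propositional using () renaming (_∉_ to _∉ₗ_)
open import Data.List.Relation.Binary.Subset.Propositional using () renaming (_⊆_ to _⊆ₗ_)
open import Data.List.Relation.Binary.Disjoint.Propositional using (Disjoint)
open import Data.List.Relation.Unary.Unique.Propositional using (Unique)
open import Data.Product.Base using (_×_; _,_; ∃; ∃-syntax; uncurry)
open import Data.Sum.Base using (_⊎_)
open import Function.Base using (_∘_; flip)
open import Function.Bundles using (_↔_; Inverse)
open import Relation.Binary.Core using (Rel; _⇔_)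
open import Relation.Binary.Structures using (IsStrictPartialOrder)
open import Relation.Binary.PropositionalEquality.Core using (_≡_; _≢_)
open import Relation.Binary.Construct.Closure.ReflexiveTransitive using (Star)
open import Relation.Binary.Construct.Closure.Symmetric using (SymClosure)
open import Relation.Binary.Construct.Closure.Equivalence using (EqClosure)
open import Relation.Binary.Rewriting using (Confluent; StronglyNormalizing)
open import Relation.Nullary.Negation.Core using (¬_)
open import Relation.Unary using (Pred; _∈_; _∉_; _⊆_; _≐_; _∪_; ｛_｝; _~; ⋃)
open import Induction.WellFounded using (WellFounded)

-- No finite list exhausts A.
Infinite : Set → Set
Infinite A = (xs : List A) → ∃[ x ] x ∉ₗ xs

record Signature : Set₁ where
  field
    Symbol : Set
    arity  : Symbol → ℕ

module TermRewriting (𝓕 : Signature) (V : Set) where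

  open Signature 𝓕

  infixl 9 _·_ _∣_
  infix  4 _⊵_ _⊳_

  data Term : Set where
    var : V → Term
    fun : (f : Symbol) → Vec Term (arity f) → Term

  vars  : Term → List V
  vars* : ∀ {n} → Vec Term n → List V
  vars (var x)    = x ∷ []
  vars (fun _ ts) = vars* ts
  vars* []        = []
  vars* (t ∷ ts)  = vars t ++ vars* ts

  NonVariable : Term → Set
  NonVariable t = ∀ x → t ≢ var x

  Subst : Set
  Subst = V → Term

  _·_  : Term → Subst → Term
  _·*_ : ∀ {n} → Vec Term n → Subst → Vec Term n
  var x    · σ  = σ x
  fun f ts · σ  = fun f (ts ·* σ)
  []       ·* σ = []
  (t ∷ ts) ·* σ = (t · σ) ∷ (ts ·* σ)

  -- In `fun f i ts C` the i-th entry of ts is irrelevant: it is overwritten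
  -- when the context is filled.
  data Context : Set where
    □   : Context
    fun : (f : Symbol) → Fin (arity f) → Vec Term (arity f) → Context → Context

  _⟦_⟧ : Context → Term → Term
  □            ⟦ t ⟧ = t
  fun f i ts C ⟦ t ⟧ = fun f (ts [ i ]≔ (C ⟦ t ⟧))

  data Pos : Term → Set where
    ε   : ∀ {t} → Pos t
    _∙_ : ∀ {f ts} (i : Fin (arity f)) → Pos (lookup ts i) → Pos (fun f ts)

  _∣_ : (t : Term) → Pos t → Term
  t        ∣ ε       = t
  fun f ts ∣ (i ∙ p) = lookup ts i ∣ p

  _[_]at_ : (t : Term) → Term → Pos t → Term
  t        [ s ]at ε       = s
  fun f ts [ s ]at (i ∙ p) = fun f (ts [ i ]≔ (lookup ts i [ s ]at p))

  _⊵_ : Rel Term 0ℓ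
  s ⊵ t = ∃[ C ] ∃[ σ ] s ≡ C ⟦ t · σ ⟧

  _⊳_ : Rel Term 0ℓ
  s ⊳ t = s ⊵ t × ¬ (t ⊵ s)

  -- Both equations s ≈ t and rules s → t are ordered pairs.
  Eqn : Set
  Eqn = Term × Term

  ES : Set₁
  ES = Pred Eqn 0ℓ

  varsₑ : Eqn → List V
  varsₑ (s , t) = vars s ++ vars t

  LinearEqn : Eqn → Set
  LinearEqn (s , t) = Unique (vars s) × Unique (vars t)

  LinearES : ES → Set
  LinearES X = ∀ e → e ∈ X → LinearEqn e

  IsTRS : ES → Set
  IsTRS X = ∀ ℓ r → (ℓ , r) ∈ X → NonVariable ℓ × vars r ⊆ₗ vars ℓ

  infix 10 _±
  _± : ES → ES
  X ± = X ∪ X ~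

  data Step (X : ES) : Rel Term 0ℓ where
    step : ∀ {ℓ r} → (ℓ , r) ∈ X → (C : Context) (σ : Subst) →
           Step X (C ⟦ ℓ · σ ⟧) (C ⟦ r · σ ⟧)

  Conversion : ES → Rel Term 0ℓ
  Conversion X = EqClosure (Step X)

  Joinable : ES → Rel Term 0ℓ
  Joinable X s t = ∃[ u ] Star (Step X) s u × Star (Step X) t u

  record Complete (X : ES) : Set where
    field
      terminating : StronglyNormalizing (Step X)
      confluent   : Confluent (Step X)

  record CompletePresentation (R E : ES) : Set where
    field
      isTRS      : IsTRS R
      complete   : Complete R
      conversion : Conversion R ⇔ Conversion E

  record IsReductionOrder (_>_ : Rel Term 0ℓ) : Set where
    field
      isStrictPartialOrder : IsStrictPartialOrder _≡_ _>_
      wellFounded          : WellFounded (flip _>_)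
      closed-context       : ∀ {s t} (C : Context) → s > t → (C ⟦ s ⟧) > (C ⟦ t ⟧)
      closed-subst         : ∀ {s t} (σ : Subst) → s > t → (s · σ) > (t · σ)

  Variant : Rel Eqn 0ℓ
  Variant (s′ , t′) (s , t) =
    ∃[ ρ ] s′ ≡ s · rename ρ × t′ ≡ t · rename ρ
    where
    rename : V ↔ V → Subst
    rename ρ = var ∘ Inverse.to ρ

  Unifier : Term → Term → Pred Subst 0ℓ
  Unifier s t σ = s · σ ≡ t · σ

  IsMGU : Term → Term → Pred Subst 0ℓ
  IsMGU s t μ = μ ∈ Unifier s t ×
    (∀ σ → σ ∈ Unifier s t → ∃[ τ ] (∀ x → σ x ≡ μ x · τ))

  module LinearCompletion (_>_ : Rel Term 0ℓ) where

    infix 4 _≯_ _⊢ₗ_ _≐_⊎｛_｝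

    _≯_ : Rel Term 0ℓ
    s ≯ t = ¬ (s > t)

    _≐_⊎｛_｝ : ES → ES → Eqn → Set
    X ≐ Y ⊎｛ e ｝ = e ∉ Y × X ≐ Y ∪ ｛ e ｝

    -- One inference step. Sets are predicates, compared extensionally by ≐;
    -- E and R in a constructor are the metavariables of the rule schema, i.e.
    -- what remains after removing the displayed equation or rule.
    data _⊢ₗ_ : Rel (ES × ES) (lsuc 0ℓ) where

      deduce : ∀ {E R E′ R′ s t u} →
        Step (E ± ∪ R) u s → Step (E ± ∪ R) u t → LinearEqn (s , t) →
        E′ ≐ E ∪ ｛ s , t ｝ → R′ ≐ R →
        (E , R) ⊢ₗ (E′ , R′)

      orientˡ : ∀ {E₁ R E₂ R′ s t} (E : ES) →
        s > t →
        E₁ ≐ E ⊎｛ s , t ｝ → E₂ ≐ E → R′ ≐ R ∪ ｛ s , t ｝ →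
        (E₁ , R) ⊢ₗ (E₂ , R′)

      orientʳ : ∀ {E₁ R E₂ R′ s t} (E : ES) →
        t > s →
        E₁ ≐ E ⊎｛ s , t ｝ → E₂ ≐ E → R′ ≐ R ∪ ｛ t , s ｝ →
        (E₁ , R) ⊢ₗ (E₂ , R′)

      delete : ∀ {E₁ R E₂ R′ s} (E : ES) →
        E₁ ≐ E ⊎｛ s , s ｝ → E₂ ≐ E → R′ ≐ R →
        (E₁ , R) ⊢ₗ (E₂ , R′)

      compose : ∀ {E R₁ E′ R₂ s t u} (R : ES) →
        Step R t u →
        R₁ ≐ R ⊎｛ s , t ｝ → E′ ≐ E → R₂ ≐ R ∪ ｛ s , u ｝ →
        (E , R₁) ⊢ₗ (E′ , R₂)

      simplifyˡ : ∀ {E₁ R E₂ R′ s t u} (E : ES) →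
        Step R s u →
        E₁ ≐ E ⊎｛ s , t ｝ → E₂ ≐ E ∪ ｛ u , t ｝ → R′ ≐ R →
        (E₁ , R) ⊢ₗ (E₂ , R′)

      simplifyʳ : ∀ {E₁ R E₂ R′ s t u} (E : ES) →
        Step R t u →
        E₁ ≐ E ⊎｛ s , t ｝ → E₂ ≐ E ∪ ｛ s , u ｝ → R′ ≐ R →
        (E₁ , R) ⊢ₗ (E₂ , R′)

      collapse : ∀ {E R₁ E′ R₂ s t u ℓ r} (R : ES) →
        (ℓ , r) ∈ R → Step ｛ ℓ , r ｝ t u → t ⊳ ℓ →
        R₁ ≐ R ⊎｛ t , s ｝ → E′ ≐ E ∪ ｛ u , s ｝ → R₂ ≐ R →
        (E , R₁) ⊢ₗ (E′ , R₂)

    IsRun : (ℕ → ES) → (ℕ → ES) → Set₁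
    IsRun E R = ∀ i → (E i , R i) ⊢ₗ (E (suc i) , R (suc i))

    _∞ : (ℕ → ES) → ES
    X ∞ = ⋃ ℕ X

    _ω : (ℕ → ES) → ES
    X ω = ⋃ ℕ λ i e → ∀ j → i ≤ j → e ∈ X j

    record IsExtendedOverlap (E : ES) (ℓ₁ r₁ ℓ₂ r₂ : Term)
                             (p : Pos ℓ₂) (μ : Subst) : Set where
      field
        variant₁    : ∃[ e ] e ∈ E ± × Variant (ℓ₁ , r₁) e
        variant₂    : ∃[ e ] e ∈ E ± × Variant (ℓ₂ , r₂) e
        disjoint    : Disjoint (varsₑ (ℓ₁ , r₁)) (varsₑ (ℓ₂ , r₂))
        nonVariable : NonVariable (ℓ₂ ∣ p)
        mgu         : IsMGU ℓ₁ (ℓ₂ ∣ p) μ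
        unordered₁  : r₁ · μ ≯ ℓ₁ · μ
        unordered₂  : r₂ · μ ≯ ℓ₂ · μ

    LCP : ES → ES
    LCP E (s , t) =
      ∃[ ℓ₁ ] ∃[ r₁ ] ∃[ ℓ₂ ] ∃[ r₂ ] ∃[ p ] ∃[ μ ]
        IsExtendedOverlap E ℓ₁ r₁ ℓ₂ r₂ p μ ×
        ((ℓ₁ > r₁ × r₂ ≯ ℓ₂) ⊎ (ℓ₂ > r₂ × r₁ ≯ ℓ₁)) ×
        s ≡ (ℓ₂ [ r₁ ]at p) · μ ×
        t ≡ r₂ · μ

    Fair : (ℕ → ES) → (ℕ → ES) → Set
    Fair E R =
      LCP (E ω ∪ R ω) ⊆
        uncurry (Joinable (R ω)) ∪ uncurry (SymClosure (Step (E ∞)))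

{-# OPTIONS --safe --termination-depth=2 #-}

-- Every rule that ever occurs is oriented by >. Let P be a set of terms that is
-- closed downwards under >. An equation or rule that is not persistent is at some
-- point replaced by a conversion through smaller terms, so by well-founded induction
-- each step of E∞ ∪ R∞ with both ends in P becomes an Rω-conversion inside P: for
-- rules, the induction is on the source of the step, then on the left-hand side by
-- proper encompassment, then on the right-hand side. For P = everything this gives
-- the conversions of E₀. For P = {v | u > v} it gives, by fairness, that the critical
-- peaks of Rω at u are connected below u, and a terminating relation all of whose
-- local peaks are connected below their source is confluent.

module Submission where

open import Defs
open import Level using (0ℓ)
open import Data.Nat.Base using (ℕ; zero; suc; _+_; _∸_; _≤_; _<_; z≤n; s≤s; _≤′_; ≤′-refl; ≤′-step)
import Data.Nat.Properties as ℕ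
open import Data.Nat.Induction using (<-wellFounded)
open import Data.Fin.Base using (zero; suc)
open import Data.Vec.Base using (Vec; []; _∷_; lookup; _[_]≔_)
import Data.Vec.Properties as Vec
open import Data.List.Base using (List; []; _∷_; _++_; map; length)
open import Data.List.Properties using (map-++; length-map)
open import Data.List.Relation.Unary.Any using (here; there)
open import Data.List.Relation.Unary.All using (All; []; _∷_)
open import Data.List.Membership.Propositional renaming (_∈_ to _∈ₗ_; _∉_ to _∉ₗ_)
open import Data.List.Membership.Propositional.Properties
  using (∈-++⁺ˡ; ∈-++⁺ʳ; ∈-++⁻; ∈-map⁺; ∈-map⁻)
open import Data.List.Relation.Binary.Subset.Propositional using () renaming (_⊆_ to _⊆ₗ_)
open import Data.Product.Base using (Σ; _×_; _,_; ∃; ∃-syntax; proj₁; proj₂; uncurry)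
open import Data.Product.Relation.Binary.Lex.Strict using (×-Lex; ×-wellFounded)
open import Data.Sum.Base using (_⊎_; inj₁; inj₂)
open import Data.Unit.Base using (⊤)
open import Function.Base using (_∘_; flip)
open import Function.Bundles using (_↔_; Inverse; mk↔ₛ′)
open import Function.Construct.Identity using (↔-id)
open import Function.Construct.Composition using (_↔-∘_)
open import Axiom.ExcludedMiddle using (ExcludedMiddle)
open import Relation.Binary.Core using (Rel)
open import Relation.Binary.PropositionalEquality
  using (_≡_; _≢_; refl; sym; trans; cong; cong₂; subst; subst₂)
open import Relation.Binary.Construct.Closure.ReflexiveTransitive as Star
  using (Star; ε; _◅_; _◅◅_)
open import Relation.Binary.Construct.Closure.Symmetric as Sym using (SymClosure; fwd; bwd)
open import Relation.Binary.Construct.Closure.Equivalence as Eq using (EqClosure)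
import Relation.Binary.Construct.On as On
open import Relation.Binary.Definitions using (Transitive)
open import Relation.Binary.Structures using (IsStrictPartialOrder)
open import Relation.Binary.Rewriting using (Confluent)
open import Relation.Nullary.Decidable.Core using (Dec; yes; no)
open import Relation.Nullary.Negation.Core using (¬_; contradiction)
open import Relation.Unary using (Pred; Empty; _∈_; _∪_; _⊆_; ｛_｝)
open import Induction.WellFounded using (WellFounded; Acc; acc; module Subrelation)

-- Confluence from connectedness of local peaks.

module _ {A : Set} {_⟶_ _>_ : Rel A 0ℓ} (>-trans : Transitive _>_) (>-wf : WellFounded (flip _>_))
         (⟶⊆> : ∀ {x y} → x ⟶ y → x > y) where

  -- Newman's argument by well-founded induction on the source of the peak. The conversion between
  -- the two one-step reducts is collapsed to a valley from its far end: a forward step just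
  -- lengthens one side, and a backward step creates a peak whose source lies below `x`, where the
  -- induction hypothesis applies.
  connectedBelow⇒confluent :
    (∀ {x y z} → x ⟶ y → x ⟶ z → EqClosure (λ a b → a ⟶ b × x > a) y z) → Confluent _⟶_
  connectedBelow⇒confluent connected = confluentAt (>-wf _)
    where
    ConfluentAt : A → Set
    ConfluentAt x = ∀ {y z} → Star _⟶_ x y → Star _⟶_ x z → ∃[ w ] Star _⟶_ y w × Star _⟶_ z w

    join : ∀ {x} → (∀ {y} → x > y → ConfluentAt y) →
           ∀ {y z} → EqClosure (λ a b → a ⟶ b × x > a) y z → ∃[ w ] Star _⟶_ y w × Star _⟶_ z w
    join ih ε = _ , ε , ε
    join ih (fwd (y→a , _) ◅ a↔z) with join ih a↔z
    ... | w , a↠w , z↠w = w , y→a ◅ a↠w , z↠w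
    join ih (bwd (a→y , x>a) ◅ a↔z) with join ih a↔z
    ... | w , a↠w , z↠w with ih x>a (a→y ◅ ε) a↠w
    ...   | v , y↠v , w↠v = v , y↠v , z↠w ◅◅ w↠v

    confluentAt : ∀ {x} → Acc (flip _>_) x → ConfluentAt x
    confluentAt _ ε x↠z = _ , x↠z , ε
    confluentAt _ x↠y@(_ ◅ _) ε = _ , ε , x↠y
    confluentAt (acc rs) (x→y′ ◅ y′↠y) (x→z′ ◅ z′↠z)
      with join (λ x>a → confluentAt (rs x>a)) (connected x→y′ x→z′)
    ... | v , y′↠v , z′↠v with confluentAt (rs (⟶⊆> x→y′)) y′↠y y′↠v
    ...   | w , y↠w , v↠w with confluentAt (rs (⟶⊆> x→z′)) z′↠z (z′↠v ◅◅ v↠w)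
    ...     | u , z↠u , w↠u = u , y↠w ◅◅ w↠u , z↠u

-- Substitutions, contexts, rewrite steps and term size.

module Terms (𝓕 : Signature) (V : Set) where

  open Signature 𝓕
  open TermRewriting 𝓕 V

  ·-cong  : ∀ t {σ τ} → (∀ x → x ∈ₗ vars t → σ x ≡ τ x) → t · σ ≡ t · τ
  ·*-cong : ∀ {n} (ts : Vec Term n) {σ τ} →
            (∀ x → x ∈ₗ vars* ts → σ x ≡ τ x) → ts ·* σ ≡ ts ·* τ
  ·-cong (var x)    h = h x (here refl)
  ·-cong (fun f ts) h = cong (fun f) (·*-cong ts h)
  ·*-cong []       h = refl
  ·*-cong (t ∷ ts) h =
    cong₂ _∷_ (·-cong t λ x x∈ → h x (∈-++⁺ˡ x∈))
              (·*-cong ts λ x x∈ → h x (∈-++⁺ʳ (vars t) x∈))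

  ·-identity  : ∀ t → t · var ≡ t
  ·*-identity : ∀ {n} (ts : Vec Term n) → ts ·* var ≡ ts
  ·-identity (var x)    = refl
  ·-identity (fun f ts) = cong (fun f) (·*-identity ts)
  ·*-identity []       = refl
  ·*-identity (t ∷ ts) = cong₂ _∷_ (·-identity t) (·*-identity ts)

  ·-assoc  : ∀ t σ τ → t · σ · τ ≡ t · (λ x → σ x · τ)
  ·*-assoc : ∀ {n} (ts : Vec Term n) σ τ → (ts ·* σ) ·* τ ≡ ts ·* (λ x → σ x · τ)
  ·-assoc (var x)    σ τ = refl
  ·-assoc (fun f ts) σ τ = cong (fun f) (·*-assoc ts σ τ)
  ·*-assoc []       σ τ = refl
  ·*-assoc (t ∷ ts) σ τ = cong₂ _∷_ (·-assoc t σ τ) (·*-assoc ts σ τ)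

  lookup-·* : ∀ {n} (ts : Vec Term n) i σ → lookup (ts ·* σ) i ≡ lookup ts i · σ
  lookup-·* (t ∷ ts) zero    σ = refl
  lookup-·* (t ∷ ts) (suc i) σ = lookup-·* ts i σ

  []≔-·* : ∀ {n} (ts : Vec Term n) i s σ → (ts [ i ]≔ s) ·* σ ≡ (ts ·* σ) [ i ]≔ (s · σ)
  []≔-·* (t ∷ ts) zero    s σ = refl
  []≔-·* (t ∷ ts) (suc i) s σ = cong (t · σ ∷_) ([]≔-·* ts i s σ)

  fun-injective : ∀ {f g ts us} → fun f ts ≡ fun g us →
                  Σ (f ≡ g) λ f≡g → subst (Vec Term ∘ arity) f≡g ts ≡ us
  fun-injective refl = refl , refl

  substContext : Context → Subst → Context
  substContext □              σ = □
  substContext (fun f i ts C) σ = fun f i (ts ·* σ) (substContext C σ)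

  ⟦⟧-· : ∀ C t σ → (C ⟦ t ⟧) · σ ≡ substContext C σ ⟦ t · σ ⟧
  ⟦⟧-· □              t σ = refl
  ⟦⟧-· (fun f i ts C) t σ =
    cong (fun f) (trans ([]≔-·* ts i (C ⟦ t ⟧) σ) (cong (ts ·* σ [ i ]≔_) (⟦⟧-· C t σ)))

  _∘ᶜ_ : Context → Context → Context
  □            ∘ᶜ D = D
  fun f i ts C ∘ᶜ D = fun f i ts (C ∘ᶜ D)

  ∘ᶜ-⟦⟧ : ∀ C D t → (C ∘ᶜ D) ⟦ t ⟧ ≡ C ⟦ D ⟦ t ⟧ ⟧
  ∘ᶜ-⟦⟧ □              D t = refl
  ∘ᶜ-⟦⟧ (fun f i ts C) D t = cong (λ s → fun f (ts [ i ]≔ s)) (∘ᶜ-⟦⟧ C D t)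

  ∈-vars* : ∀ {n} (ts : Vec Term n) {x} → x ∈ₗ vars* ts → ∃[ i ] x ∈ₗ vars (lookup ts i)
  ∈-vars* (t ∷ ts) x∈ with ∈-++⁻ (vars t) x∈
  ... | inj₁ x∈t = zero , x∈t
  ... | inj₂ x∈ts with ∈-vars* ts x∈ts
  ...   | i , x∈tᵢ = suc i , x∈tᵢ

  -- The vector version exhibits `ts ·* σ` as an update of itself, which is the shape that filling a
  -- `fun` context produces.
  occurrence  : ∀ t {x} σ → x ∈ₗ vars t → ∃[ C ] t · σ ≡ C ⟦ σ x ⟧
  occurrence* : ∀ {n} (ts : Vec Term n) {x} σ → x ∈ₗ vars* ts →
                ∃[ i ] ∃[ C ] ts ·* σ ≡ (ts ·* σ) [ i ]≔ (C ⟦ σ x ⟧)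
  occurrence (var y)    σ (here refl) = □ , refl
  occurrence (fun f ts) σ x∈ with occurrence* ts σ x∈
  ... | i , C , eq = fun f i (ts ·* σ) C , cong (fun f) eq
  occurrence* (t ∷ ts) σ x∈ with ∈-++⁻ (vars t) x∈
  ... | inj₁ x∈t with occurrence t σ x∈t
  ...   | C , eq = zero , C , cong (_∷ _) eq
  occurrence* (t ∷ ts) σ x∈ | inj₂ x∈ts with occurrence* ts σ x∈ts
  ...   | i , C , eq = suc i , C , cong (_ ∷_) eq

  mkStep : ∀ {X ℓ r s t} → (ℓ , r) ∈ X → ∀ C σ → s ≡ C ⟦ ℓ · σ ⟧ → t ≡ C ⟦ r · σ ⟧ → Step X s t
  mkStep e∈X C σ refl refl = step e∈X C σ

  step-respˡ : ∀ {X s s′ t} → s ≡ s′ → Step X s t → Step X s′ t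
  step-respˡ refl h = h

  step-context : ∀ {X s t} C → Step X s t → Step X (C ⟦ s ⟧) (C ⟦ t ⟧)
  step-context C (step {ℓ} {r} e∈X D σ) =
    mkStep e∈X (C ∘ᶜ D) σ (sym (∘ᶜ-⟦⟧ C D (ℓ · σ))) (sym (∘ᶜ-⟦⟧ C D (r · σ)))

  step-subst : ∀ {X s t} σ → Step X s t → Step X (s · σ) (t · σ)
  step-subst σ (step {ℓ} {r} e∈X D τ) =
    mkStep e∈X (substContext D σ) (λ x → τ x · σ) (push ℓ) (push r)
    where
    push : ∀ t → (D ⟦ t · τ ⟧) · σ ≡ substContext D σ ⟦ t · (λ x → τ x · σ) ⟧
    push t = trans (⟦⟧-· D (t · τ) σ) (cong (substContext D σ ⟦_⟧) (·-assoc t τ σ))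

  step-arg : ∀ {X f s} (ts : Vec Term (arity f)) i →
             Step X (lookup ts i) s → Step X (fun f ts) (fun f (ts [ i ]≔ s))
  step-arg {X} {f} {s} ts i h =
    subst (λ us → Step X (fun f us) (fun f (ts [ i ]≔ s)))
          (Vec.[]≔-lookup ts i) (step-context (fun f i ts □) h)

  step-map : ∀ {X Y s t} → X ⊆ Y → Step X s t → Step Y s t
  step-map X⊆Y (step e∈X C σ) = step (X⊆Y e∈X) C σ

  star-args : ∀ {X f} (ts us : Vec Term (arity f)) →
              (∀ i → Star (Step X) (lookup ts i) (lookup us i)) → Star (Step X) (fun f ts) (fun f us)
  star-args {X} {f} ts us h = go (fun f) (λ vs i → step-arg vs i) ts us h
    where
    -- `F` is `fun f` with a prefix of arguments already rewritten, so that the induction can run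
    -- over vectors shorter than the arity.
    go : ∀ {n} (F : Vec Term n → Term) →
         (∀ vs i {s} → Step X (lookup vs i) s → Step X (F vs) (F (vs [ i ]≔ s))) →
         ∀ ts us → (∀ i → Star (Step X) (lookup ts i) (lookup us i)) → Star (Step X) (F ts) (F us)
    go F mono []       []       h = ε
    go F mono (t ∷ ts) (u ∷ us) h =
      Star.gmap (λ s → F (s ∷ ts)) (λ {s} → mono (s ∷ ts) zero) (h zero) ◅◅
      go (F ∘ (u ∷_)) (λ vs i → mono (u ∷ vs) (suc i)) ts us (h ∘ suc)

  star-subst : ∀ {X σ τ} → (∀ x → Star (Step X) (σ x) (τ x)) →
               ∀ t → Star (Step X) (t · σ) (t · τ)
  star-subst* : ∀ {X σ τ} → (∀ x → Star (Step X) (σ x) (τ x)) →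
                ∀ {n} (ts : Vec Term n) i → Star (Step X) (lookup (ts ·* σ) i) (lookup (ts ·* τ) i)
  star-subst h (var x)    = h x
  star-subst h (fun f ts) = star-args _ _ (star-subst* h ts)
  star-subst* h (t ∷ ts) zero    = star-subst h t
  star-subst* h (t ∷ ts) (suc i) = star-subst* h ts i

  star-context : ∀ {X s t} C → Star (Step X) s t → Star (Step X) (C ⟦ s ⟧) (C ⟦ t ⟧)
  star-context C = Star.gmap (C ⟦_⟧) (step-context C)

  -- Weighting function symbols by 2 makes variables lighter than constants, so that a
  -- substitution preserving the size of t maps the variables of t to variables.
  size  : Term → ℕ
  size* : ∀ {n} → Vec Term n → ℕ
  size (var x)    = 1
  size (fun f ts) = 2 + size* ts
  size* []        = 0
  size* (t ∷ ts)  = size t + size* ts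

  0<size : ∀ t → 0 < size t
  0<size (var x)    = s≤s z≤n
  0<size (fun f ts) = s≤s z≤n

  size-lookup : ∀ {n} (ts : Vec Term n) i → size (lookup ts i) ≤ size* ts
  size-lookup (t ∷ ts) zero    = ℕ.m≤m+n (size t) (size* ts)
  size-lookup (t ∷ ts) (suc i) = ℕ.≤-trans (size-lookup ts i) (ℕ.m≤n+m (size* ts) (size t))

  size-⟦⟧ : ∀ C t → size t ≤ size (C ⟦ t ⟧)
  size-fun-⟦⟧ : ∀ f i ts C t → size t < size (fun f i ts C ⟦ t ⟧)
  size-⟦⟧ □              t = ℕ.≤-refl
  size-⟦⟧ (fun f i ts C) t = ℕ.<⇒≤ (size-fun-⟦⟧ f i ts C t)
  size-fun-⟦⟧ f i ts C t = s≤s (ℕ.m≤n⇒m≤1+n (ℕ.≤-trans (size-⟦⟧ C t)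
    (subst (λ u → size u ≤ size* (ts [ i ]≔ (C ⟦ t ⟧)))
           (Vec.lookup∘update i ts (C ⟦ t ⟧)) (size-lookup (ts [ i ]≔ (C ⟦ t ⟧)) i))))

  size-·  : ∀ t σ → size t ≤ size (t · σ)
  size*-· : ∀ {n} (ts : Vec Term n) σ → size* ts ≤ size* (ts ·* σ)
  size-· (var x)    σ = 0<size (σ x)
  size-· (fun f ts) σ = s≤s (s≤s (size*-· ts σ))
  size*-· []       σ = z≤n
  size*-· (t ∷ ts) σ = ℕ.+-mono-≤ (size-· t σ) (size*-· ts σ)

  -- Reads off the variable of a term that is known to be one; the second argument is only a default
  -- for the other terms.
  name : Term → V → V
  name (var y)   x = y
  name (fun _ _) x = x

  -- By `size-·` no argument shrinks under `σ`. If the total is unchanged, then so is the size of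
  -- each argument, down to the single variables, and only variables have size 1.
  size-·-≡⇒var  : ∀ t σ → size (t · σ) ≡ size t → ∀ x → x ∈ₗ vars t → σ x ≡ var (name (σ x) x)
  size*-·-≡⇒var : ∀ {n} (ts : Vec Term n) σ → size* (ts ·* σ) ≡ size* ts →
                  ∀ x → x ∈ₗ vars* ts → σ x ≡ var (name (σ x) x)
  size-·-≡⇒var (var x) σ eq x (here refl) with σ x | eq
  ... | var y   | _  = refl
  ... | fun _ _ | ()
  size-·-≡⇒var (fun f ts) σ eq x x∈ =
    size*-·-≡⇒var ts σ (ℕ.suc-injective (ℕ.suc-injective eq)) x x∈
  size*-·-≡⇒var (t ∷ ts) σ eq x x∈ with ∈-++⁻ (vars t) x∈
  ... | inj₁ x∈t  = size-·-≡⇒var t σ (ℕ.≤-antisym (ℕ.+-cancelʳ-≤ (size* ts) _ _ le) (size-· t σ)) x x∈t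
    where
    le : size (t · σ) + size* ts ≤ size t + size* ts
    le = ℕ.≤-trans (ℕ.+-monoʳ-≤ (size (t · σ)) (size*-· ts σ)) (ℕ.≤-reflexive eq)
  ... | inj₂ x∈ts = size*-·-≡⇒var ts σ (ℕ.≤-antisym (ℕ.+-cancelˡ-≤ (size t) _ _ le) (size*-· ts σ)) x x∈ts
    where
    le : size t + size* (ts ·* σ) ≤ size t + size* ts
    le = ℕ.≤-trans (ℕ.+-monoˡ-≤ (size* (ts ·* σ)) (size-· t σ)) (ℕ.≤-reflexive eq)

  vars-rename  : ∀ t f → vars (t · (var ∘ f)) ≡ map f (vars t)
  vars*-rename : ∀ {n} (ts : Vec Term n) f → vars* (ts ·* (var ∘ f)) ≡ map f (vars* ts)
  vars-rename (var x)    f = refl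
  vars-rename (fun _ ts) f = vars*-rename ts f
  vars*-rename []       f = refl
  vars*-rename (t ∷ ts) f =
    trans (cong₂ _++_ (vars-rename t f) (vars*-rename ts f)) (sym (map-++ f (vars t) (vars* ts)))

-- Well-foundedness of proper encompassment.

module Classical (em : ExcludedMiddle 0ℓ) (𝓕 : Signature) (V : Set) where

  open Signature 𝓕
  open TermRewriting 𝓕 V
  open Terms 𝓕 V

  distinct : List V → ℕ
  distinct [] = 0
  distinct (x ∷ xs) with em {x ∈ₗ xs}
  ... | yes _ = distinct xs
  ... | no  _ = suc (distinct xs)

  distinct≤length : ∀ xs → distinct xs ≤ length xs
  distinct≤length [] = z≤n
  distinct≤length (x ∷ xs) with em {x ∈ₗ xs}
  ... | yes _ = ℕ.m≤n⇒m≤1+n (distinct≤length xs)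
  ... | no  _ = s≤s (distinct≤length xs)

  distinct-map : ∀ f xs → distinct (map f xs) ≤ distinct xs
  distinct-map f [] = z≤n
  distinct-map f (x ∷ xs) with em {x ∈ₗ xs} | em {f x ∈ₗ map f xs}
  ... | yes _  | yes _   = distinct-map f xs
  ... | yes x∈ | no fx∉  = contradiction (∈-map⁺ f x∈) fx∉
  ... | no _   | yes _   = ℕ.m≤n⇒m≤1+n (distinct-map f xs)
  ... | no _   | no _    = s≤s (distinct-map f xs)

  InjectiveOn : List V → (V → V) → Set
  InjectiveOn xs f = ∀ {x y} → x ∈ₗ xs → y ∈ₗ xs → f x ≡ f y → x ≡ y

  -- If `f` identified two different entries, some entry counted in `xs` would go uncounted in the
  -- image, and by `distinct-map` the rest of the list cannot make up for that loss.
  distinct-map-≡⇒injective : ∀ f xs → distinct (map f xs) ≡ distinct xs → InjectiveOn xs f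
  distinct-map-≡⇒injective f (z ∷ zs) eq with em {z ∈ₗ zs} | em {f z ∈ₗ map f zs}
  ... | yes z∈ | yes _  = λ x∈ y∈ → distinct-map-≡⇒injective f zs eq (drop x∈) (drop y∈)
    where
    drop : ∀ {x} → x ∈ₗ z ∷ zs → x ∈ₗ zs
    drop (here refl) = z∈
    drop (there x∈)  = x∈
  ... | yes z∈ | no fz∉ = contradiction (∈-map⁺ f z∈) fz∉
  ... | no _   | yes _  = contradiction (ℕ.≤-reflexive (sym eq)) (ℕ.≤⇒≯ (distinct-map f zs))
  ... | no _   | no fz∉ = inj
    where
    inj : InjectiveOn (z ∷ zs) f
    inj (here refl) (here refl) _ = refl
    inj (here refl) (there y∈) fz≡fy = contradiction (subst (_∈ₗ map f zs) (sym fz≡fy) (∈-map⁺ f y∈)) fz∉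
    inj (there x∈) (here refl) fx≡fz = contradiction (subst (_∈ₗ map f zs) fx≡fz (∈-map⁺ f x∈)) fz∉
    inj (there x∈) (there y∈) =
      distinct-map-≡⇒injective f zs (ℕ.suc-injective eq) x∈ y∈

  leftInverse : List V → (V → V) → Subst
  leftInverse xs f z with em {∃[ x ] (x ∈ₗ xs × f x ≡ z)}
  ... | yes (x , _) = var x
  ... | no  _       = var z

  leftInverse-inverse : ∀ xs f → InjectiveOn xs f → ∀ {x} → x ∈ₗ xs → leftInverse xs f (f x) ≡ var x
  leftInverse-inverse xs f inj {x} x∈ with em {∃[ y ] (y ∈ₗ xs × f y ≡ f x)}
  ... | yes (y , y∈ , fy≡fx) = cong var (inj y∈ x∈ fy≡fx)
  ... | no  ¬∃               = contradiction (x , x∈ , refl) ¬∃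

  -- A renaming that is injective on the variables of `t` is undone by `leftInverse`, so the renamed
  -- term matches back to `t` in the empty context.
  rename-⊵ : ∀ t f → InjectiveOn (vars t) f → t ⊵ (t · (var ∘ f))
  rename-⊵ t f inj = □ , leftInverse (vars t) f , sym (trans (·-assoc t _ _)
    (trans (·-cong t λ x x∈ → leftInverse-inverse (vars t) f inj x∈) (·-identity t)))

  -- The second component counts repeated variable occurrences. It grows when a renaming identifies
  -- variables, a change that size does not detect.
  complexity : Term → ℕ × ℕ
  complexity t = size t , length (vars t) ∸ distinct (vars t)

  _<ₗₑₓ_ : Rel (ℕ × ℕ) 0ℓ
  _<ₗₑₓ_ = ×-Lex _≡_ _<_ _<_

  -- A substitution instance of the same size is a renaming; it is proper only if
  -- it identifies variables.
  ⊳⇒complexity : ∀ {s t} → s ⊳ t → complexity t <ₗₑₓ complexity s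
  ⊳⇒complexity {t = t} ((fun f i ts C , σ , refl) , _) =
    inj₁ (ℕ.≤-<-trans (size-· t σ) (size-fun-⟦⟧ f i ts C (t · σ)))
  ⊳⇒complexity {t = t} ((□ , σ , refl) , t⋭s) with ℕ.m≤n⇒m<n∨m≡n (size-· t σ)
  ... | inj₁ lt = inj₁ lt
  ... | inj₂ eq = inj₂ (eq , subst (λ n → n ∸ distinct (vars t) < length (vars s) ∸ distinct (vars s))
    lengths (ℕ.∸-monoʳ-< fewer (ℕ.≤-trans (distinct≤length (vars t)) (ℕ.≤-reflexive (sym lengths)))))
    where
    s = t · σ
    f : V → V
    f x = name (σ x) x
    s≡ : s ≡ t · (var ∘ f)
    s≡ = ·-cong t (size-·-≡⇒var t σ (sym eq))
    vars≡ : vars s ≡ map f (vars t)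
    vars≡ = trans (cong vars s≡) (vars-rename t f)
    lengths : length (vars s) ≡ length (vars t)
    lengths = trans (cong length vars≡) (length-map f (vars t))
    fewer : distinct (vars s) < distinct (vars t)
    fewer = ℕ.≤∧≢⇒< (subst (λ xs → distinct xs ≤ _) (sym vars≡) (distinct-map f (vars t)))
      λ same → t⋭s (subst (t ⊵_) (sym s≡) (rename-⊵ t f
        (distinct-map-≡⇒injective f (vars t) (trans (cong distinct (sym vars≡)) same))))

  ⊳-wellFounded : WellFounded (flip _⊳_)
  ⊳-wellFounded = Subrelation.wellFounded ⊳⇒complexity
    (On.wellFounded complexity (×-wellFounded <-wellFounded <-wellFounded))

  -- Unification: existence of most general unifiers.

  infix 10 _[_↦_]
  _[_↦_] : Subst → V → Term → Subst
  (σ [ x ↦ s ]) y with em {x ≡ y}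
  ... | yes _ = s
  ... | no  _ = σ y

  [↦]-updates : ∀ σ x s → (σ [ x ↦ s ]) x ≡ s
  [↦]-updates σ x s with em {x ≡ x}
  ... | yes _  = refl
  ... | no x≢x = contradiction refl x≢x

  [↦]-minimal : ∀ σ {x y} s → x ≢ y → (σ [ x ↦ s ]) y ≡ σ y
  [↦]-minimal σ {x} {y} s x≢y with em {x ≡ y}
  ... | yes x≡y = contradiction x≡y x≢y
  ... | no  _   = refl

  ·-bind-fresh : ∀ t {x} s → x ∉ₗ vars t → t · var [ x ↦ s ] ≡ t
  ·-bind-fresh t s x∉t = trans (·-cong t fresh) (·-identity t)
    where
    fresh : ∀ y → y ∈ₗ vars t → (var [ _ ↦ s ]) y ≡ var y
    fresh y y∈t = [↦]-minimal var s λ { refl → x∉t y∈t }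

  Eqns : Set
  Eqns = List (Term × Term)

  Unifies : Eqns → Subst → Set
  Unifies es σ = All (λ (s , t) → σ ∈ Unifier s t) es

  MostGeneral : Eqns → Subst → Set
  MostGeneral es μ = Unifies es μ × (∀ σ → Unifies es σ → ∃[ τ ] (∀ x → σ x ≡ μ x · τ))

  mostGeneral-resp : ∀ {es es′ μ} → (∀ σ → Unifies es σ → Unifies es′ σ) →
                     (∀ σ → Unifies es′ σ → Unifies es σ) → MostGeneral es μ → MostGeneral es′ μ
  mostGeneral-resp to from (unif , factor) = to _ unif , λ σ u → factor σ (from σ u)

  -- Left-hand sides suffice: under a unifier both sides of an equation have the same size.
  weight : Subst → Eqns → ℕ
  weight σ [] = 0
  weight σ ((s , _) ∷ es) = size (s · σ) + weight σ es

  bindAll : V → Term → Eqns → Eqns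
  bindAll x t = map λ (s , s′) → s · var [ x ↦ t ] , s′ · var [ x ↦ t ]

  -- A `σ` that already equates `x` with `t` does not notice the replacement of one by the other.
  -- Hence eliminating `x` keeps both the unifier `σ` and the weight.
  ·-bind : ∀ {x t σ} → σ x ≡ t · σ → ∀ s → (s · var [ x ↦ t ]) · σ ≡ s · σ
  ·-bind {x} {t} {σ} eq s = trans (·-assoc s _ σ) (·-cong s λ y _ → agree y)
    where
    agree : ∀ y → (var [ x ↦ t ]) y · σ ≡ σ y
    agree y with em {x ≡ y}
    ... | yes refl = sym eq
    ... | no _     = refl

  weight-bind : ∀ {x t σ} → σ x ≡ t · σ → ∀ es → weight σ (bindAll x t es) ≡ weight σ es
  weight-bind eq [] = refl
  weight-bind eq ((s , _) ∷ es) = cong₂ _+_ (cong size (·-bind eq s)) (weight-bind eq es)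

  unifies-bind⁺ : ∀ {x t σ} → σ x ≡ t · σ → ∀ {es} → Unifies es σ → Unifies (bindAll x t es) σ
  unifies-bind⁺ eq []                   = []
  unifies-bind⁺ eq {(s , s′) ∷ _} (h ∷ hs) =
    trans (·-bind eq s) (trans h (sym (·-bind eq s′))) ∷ unifies-bind⁺ eq hs

  unifies-bind⁻ : ∀ {x t μ} es → Unifies (bindAll x t es) μ →
                  Unifies es (λ y → (var [ x ↦ t ]) y · μ)
  unifies-bind⁻ []             []       = []
  unifies-bind⁻ ((s , s′) ∷ es) (h ∷ hs) =
    trans (sym (·-assoc s _ _)) (trans h (·-assoc s′ _ _)) ∷ unifies-bind⁻ es hs

  -- The candidate binds `x` to `t` and then applies `μ`. Since `x` does not occur in `t`, the
  -- binding fixes `t`, which solves the eliminated equation. Any other unifier absorbs the binding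
  -- by `·-bind`, so its factorization through `μ` is one through the candidate.
  mostGeneral-bind : ∀ {x t es μ} → x ∉ₗ vars t → MostGeneral (bindAll x t es) μ →
                     MostGeneral ((var x , t) ∷ es) (λ y → (var [ x ↦ t ]) y · μ)
  mostGeneral-bind {x} {t} {es} {μ} x∉t (unif , factor) =
    (xμ≡tμ ∷ unifies-bind⁻ es unif) , factor′
    where
    xμ≡tμ : (var [ x ↦ t ]) x · μ ≡ t · (λ y → (var [ x ↦ t ]) y · μ)
    xμ≡tμ = trans (cong (_· μ) (trans ([↦]-updates var x t) (sym (·-bind-fresh t t x∉t))))
                  (·-assoc t _ μ)
    factor′ : ∀ σ → Unifies ((var x , t) ∷ es) σ →
              ∃[ τ ] (∀ y → σ y ≡ ((var [ x ↦ t ]) y · μ) · τ)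
    factor′ σ (eq ∷ u) with factor σ (unifies-bind⁺ eq u)
    ... | τ , σ≡μτ = τ , λ y → trans (sym (·-bind eq (var y)))
      (trans (·-cong ((var [ x ↦ t ]) y) (λ z _ → σ≡μτ z)) (sym (·-assoc ((var [ x ↦ t ]) y) μ τ)))

  zipEqns : ∀ {n} → Vec Term n → Vec Term n → Eqns → Eqns
  zipEqns []       []       es = es
  zipEqns (t ∷ ts) (u ∷ us) es = (t , u) ∷ zipEqns ts us es

  unifies-zip⁺ : ∀ {n} (ts us : Vec Term n) {σ es} → ts ·* σ ≡ us ·* σ →
                 Unifies es σ → Unifies (zipEqns ts us es) σ
  unifies-zip⁺ []       []       eq u = u
  unifies-zip⁺ (_ ∷ ts) (_ ∷ us) eq u =
    proj₁ (Vec.∷-injective eq) ∷ unifies-zip⁺ ts us (proj₂ (Vec.∷-injective eq)) u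

  unifies-zip⁻ : ∀ {n} (ts us : Vec Term n) {σ es} → Unifies (zipEqns ts us es) σ →
                 ts ·* σ ≡ us ·* σ × Unifies es σ
  unifies-zip⁻ []       []       u = refl , u
  unifies-zip⁻ (_ ∷ ts) (_ ∷ us) (h ∷ u) with unifies-zip⁻ ts us u
  ... | eq , u′ = cong₂ _∷_ h eq , u′

  weight-zip : ∀ {n} (ts us : Vec Term n) σ es →
               weight σ (zipEqns ts us es) ≡ size* (ts ·* σ) + weight σ es
  weight-zip []       []       σ es = refl
  weight-zip (t ∷ ts) (_ ∷ us) σ es =
    trans (cong (size (t · σ) +_) (weight-zip ts us σ es)) (sym (ℕ.+-assoc (size (t · σ)) _ _))

  mostGeneral-zip : ∀ {f ts us es μ} → MostGeneral (zipEqns ts us es) μ →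
                    MostGeneral ((fun f ts , fun f us) ∷ es) μ
  mostGeneral-zip {f} {ts} {us} {es} = mostGeneral-resp to from
    where
    to : ∀ σ → Unifies (zipEqns ts us es) σ → Unifies ((fun f ts , fun f us) ∷ es) σ
    to σ u with unifies-zip⁻ ts us u
    ... | eq , u′ = cong (fun f) eq ∷ u′
    from : ∀ σ → Unifies ((fun f ts , fun f us) ∷ es) σ → Unifies (zipEqns ts us es) σ
    from σ (eq ∷ u) with fun-injective eq
    ... | refl , eq* = unifies-zip⁺ ts us eq* u

  mostGeneral-swap : ∀ {s t es μ} → MostGeneral ((s , t) ∷ es) μ → MostGeneral ((t , s) ∷ es) μ
  mostGeneral-swap = mostGeneral-resp (λ { σ (h ∷ u) → sym h ∷ u }) (λ { σ (h ∷ u) → sym h ∷ u })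

  ∈-vars*⇒size≤ : ∀ {n} (ts : Vec Term n) {x} σ → x ∈ₗ vars* ts → size (σ x) ≤ size* (ts ·* σ)
  ∈-vars*⇒size≤ ts σ x∈ with occurrence* ts σ x∈
  ... | i , C , eq = ℕ.≤-trans (size-⟦⟧ C _) (subst₂ (λ t us → size t ≤ size* us)
    (Vec.lookup∘update i (ts ·* σ) _) (sym eq) (size-lookup ((ts ·* σ) [ i ]≔ (C ⟦ σ _ ⟧)) i))

  -- If `x` occurred in a term other than itself, `σ x` would be strictly smaller than `t · σ`,
  -- against their equality.
  occurs-check : ∀ t {x} σ → t ≢ var x → σ x ≡ t · σ → x ∉ₗ vars t
  occurs-check (var y)    σ t≢x eq (here refl) = t≢x refl
  occurs-check (fun f ts) σ t≢x eq x∈ =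
    ℕ.<-irrefl (cong size eq) (s≤s (ℕ.m≤n⇒m≤1+n (∈-vars*⇒size≤ ts σ x∈)))

  -- The recursive call is the parameter `rec`, so that a variable on either side of the equation
  -- can be treated alike. It asks only for the weight of the remaining equations; the caller gains
  -- from dropping the first one.
  mgu-eliminate : ∀ {σ} x t es → σ x ≡ t · σ → Unifies es σ →
                  (∀ es′ → weight σ es′ ≡ weight σ es → Unifies es′ σ → ∃ (MostGeneral es′)) →
                  ∃ (MostGeneral ((var x , t) ∷ es))
  mgu-eliminate {σ} x t es eq u rec with em {t ≡ var x}
  ... | yes refl with rec es refl u
  ...   | μ , mg = μ , mostGeneral-resp (λ _ v → refl ∷ v) (λ { _ (_ ∷ v) → v }) mg
  mgu-eliminate {σ} x t es eq u rec | no t≢x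
    with rec (bindAll x t es) (weight-bind eq es) (unifies-bind⁺ eq u)
  ... | μ , mg = _ , mostGeneral-bind (occurs-check t σ t≢x eq) mg

  -- The recursion is on the size of the equations under one fixed unifier σ, which
  -- the elimination of a variable leaves unchanged.
  mgu-exists* : ∀ σ es → Acc _<_ (weight σ es) → Unifies es σ → ∃ (MostGeneral es)
  mgu-exists* σ [] _ _ = var , [] , λ τ _ → τ , λ _ → refl
  mgu-exists* σ ((var x , t) ∷ es) (acc rs) (eq ∷ u) =
    mgu-eliminate x t es eq u λ es′ w≡ →
      mgu-exists* σ es′ (rs (ℕ.≤-<-trans (ℕ.≤-reflexive w≡) (ℕ.+-monoˡ-< (weight σ es) (0<size (σ x)))))
  mgu-exists* σ ((s@(fun _ _) , var x) ∷ es) (acc rs) (eq ∷ u)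
    with mgu-eliminate x s es (sym eq) u (λ es′ w≡ →
      mgu-exists* σ es′ (rs (ℕ.≤-<-trans (ℕ.≤-reflexive w≡) (ℕ.+-monoˡ-< (weight σ es) (0<size (s · σ))))))
  ... | μ , mg = μ , mostGeneral-swap mg
  mgu-exists* σ ((fun f ts , fun g us) ∷ es) (acc rs) (eq ∷ u) with fun-injective eq
  ... | refl , eq*
    with mgu-exists* σ (zipEqns ts us es)
           -- Stripping the common head symbol lowers the weight by 2, its contribution to `size`.
           (rs (ℕ.≤-<-trans (ℕ.≤-reflexive (weight-zip ts us σ es)) (ℕ.m≤n⇒m≤1+n ℕ.≤-refl)))
           (unifies-zip⁺ ts us eq* u)
  ... | μ , mg = μ , mostGeneral-zip mg

  mgu-exists : ∀ s t {σ} → σ ∈ Unifier s t → ∃[ μ ] μ ∈ IsMGU s t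
  mgu-exists s t {σ} eq with mgu-exists* σ ((s , t) ∷ []) (<-wellFounded _) (eq ∷ [])
  ... | μ , (h ∷ []) , factor = μ , h , λ τ eq′ → factor τ (eq′ ∷ [])

  -- Renaming apart by permutations of the variables.

  transpose : V → V → V → V
  transpose a b x with em {x ≡ a} | em {x ≡ b}
  ... | yes _ | _     = b
  ... | no _  | yes _ = a
  ... | no _  | no _  = x

  transpose-ˡ : ∀ a b → transpose a b a ≡ b
  transpose-ˡ a b with em {a ≡ a}
  ... | yes _  = refl
  ... | no a≢a = contradiction refl a≢a

  transpose-ʳ : ∀ a b → transpose a b b ≡ a
  transpose-ʳ a b with em {b ≡ a} | em {b ≡ b}
  ... | yes b≡a | _      = b≡a
  ... | no _    | yes _  = refl
  ... | no _    | no b≢b = contradiction refl b≢b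

  transpose-minimal : ∀ {a b x} → x ≢ a → x ≢ b → transpose a b x ≡ x
  transpose-minimal {a} {b} {x} x≢a x≢b with em {x ≡ a} | em {x ≡ b}
  ... | yes x≡a | _       = contradiction x≡a x≢a
  ... | no _    | yes x≡b = contradiction x≡b x≢b
  ... | no _    | no _    = refl

  transpose-involutive : ∀ a b x → transpose a b (transpose a b x) ≡ x
  transpose-involutive a b x with em {x ≡ a} | em {x ≡ b}
  ... | yes refl | _        = transpose-ʳ a b
  ... | no _     | yes refl = transpose-ˡ a b
  ... | no x≢a   | no x≢b   = transpose-minimal x≢a x≢b

  transposition : V → V → V ↔ V
  transposition a b = mk↔ₛ′ (transpose a b) (transpose a b) (transpose-involutive a b) (transpose-involutive a b)

  -- `Variant` asks for a bijection of all variables, so the renaming is built from transpositions,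
  -- each exchanging the current image of a variable with a fresh one.
  renameApart : Infinite V → ∀ xs ys → Σ (V ↔ V) λ ρ → ∀ {x} → x ∈ₗ xs → Inverse.to ρ x ∉ₗ ys
  renameApart inf [] ys = ↔-id V , λ ()
  renameApart inf (x ∷ xs) ys with renameApart inf xs ys
  -- `z` also avoids the images of `xs`: otherwise the transposition could send one of them back to
  -- the image of `x`, which may lie in `ys`.
  ... | ρ , apart with inf (ys ++ map (Inverse.to ρ) xs)
  ...   | z , z∉ = transposition (Inverse.to ρ x) z ↔-∘ ρ , apart′
    where
    to = Inverse.to ρ
    apart′ : ∀ {y} → y ∈ₗ x ∷ xs → transpose (to x) z (to y) ∉ₗ ys
    apart′ (here refl) ∈ys = z∉ (∈-++⁺ˡ (subst (_∈ₗ ys) (transpose-ˡ (to x) z) ∈ys))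
    apart′ {y} (there y∈) = moved em
      where
      moved : Dec (to y ≡ to x) → transpose (to x) z (to y) ∉ₗ ys
      moved (yes eq) ∈ys = z∉ (∈-++⁺ˡ (subst (_∈ₗ ys)
        (trans (cong (transpose (to x) z) eq) (transpose-ˡ (to x) z)) ∈ys))
      moved (no neq) ∈ys = apart y∈ (subst (_∈ₗ ys)
        (transpose-minimal neq λ eq → z∉ (∈-++⁺ʳ ys (subst (_∈ₗ map to xs) eq (∈-map⁺ to y∈)))) ∈ys)

  -- The critical pair lemma.

  []≔-overwrite : ∀ {n} (us vs : Vec Term n) i {a} b → us [ i ]≔ a ≡ vs → us [ i ]≔ b ≡ vs [ i ]≔ b
  []≔-overwrite us vs i b refl = sym (Vec.[]≔-idempotent us i)

  []≔⇒lookup : ∀ {n} (us vs : Vec Term n) i {a} → us [ i ]≔ a ≡ vs → lookup vs i ≡ a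
  []≔⇒lookup us vs i refl = Vec.lookup∘update i us _

  star-update : ∀ {X} σ x {s} → Step X (σ x) s → ∀ y → Star (Step X) (σ y) ((σ [ x ↦ s ]) y)
  star-update σ x h y with em {x ≡ y}
  ... | yes refl = h ◅ ε
  ... | no  _    = ε

  -- The second case is an overlap at or below a variable x of t: there the other
  -- occurrences of x have to be rewritten as well.
  Split : ES → Term → Subst → Context → Term → Set
  Split X t σ D a =
    (∃[ p ] NonVariable (t ∣ p) × (t ∣ p) · σ ≡ a × (∀ v → D ⟦ v · σ ⟧ ≡ (t [ v ]at p) · σ)) ⊎
    (∃[ x ] ∃[ C ] σ x ≡ C ⟦ a ⟧ ×
      (∀ b → Step X a b → Star (Step X) (D ⟦ b ⟧) (t · σ [ x ↦ C ⟦ b ⟧ ])))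

  -- The path to the hole of `D` is followed down `t`. Either it ends at a function symbol of `t`,
  -- or it first meets a variable, and the rest of `D` then lies inside the value of that variable.
  split : ∀ X t σ D a → t · σ ≡ D ⟦ a ⟧ → Split X t σ D a
  split X (var x) σ D a eq = inj₂ (x , D , eq , λ b _ →
    subst (λ s → Star (Step X) (D ⟦ b ⟧) s) (sym ([↦]-updates σ x (D ⟦ b ⟧))) ε)
  split X (fun f ts) σ □ a eq = inj₁ (ε , (λ _ ()) , eq , λ _ → refl)
  split X (fun f ts) σ (fun g i us D) a eq with fun-injective (sym eq)
  ... | refl , eq* with split X (lookup ts i) σ D a
                          (trans (sym (lookup-·* ts i σ)) ([]≔⇒lookup us (ts ·* σ) i eq*))
  -- The vectors `us` and `ts ·* σ` can differ only at index `i`, and the update overwrites that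
  -- entry.
  ...   | inj₁ (p , nv , a≡ , plug) = inj₁ (i ∙ p , nv , a≡ , λ v → cong (fun f)
    (trans (cong (us [ i ]≔_) (plug v)) (trans ([]≔-overwrite us (ts ·* σ) i _ eq*) (sym ([]≔-·* ts i _ σ)))))
  ...   | inj₂ (x , C , σx≡ , join) = inj₂ (x , C , σx≡ , λ b a→b →
    subst (λ vs → Star (Step X) (fun f vs) _) (sym ([]≔-overwrite us (ts ·* σ) i (D ⟦ b ⟧) eq*))
      (star-args _ _ (pointwise b a→b)))
    where
    pointwise : ∀ b → Step X a b → ∀ j →
      Star (Step X) (lookup ((ts ·* σ) [ i ]≔ (D ⟦ b ⟧)) j) (lookup (ts ·* (σ [ x ↦ C ⟦ b ⟧ ])) j)
    -- The argument with the redex is handled recursively; in every other argument all copies of `a`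
    -- that stem from `x` are rewritten.
    pointwise b a→b j with em {j ≡ i}
    ... | yes refl = subst₂ (Star (Step X))
      (sym (Vec.lookup∘update i (ts ·* σ) (D ⟦ b ⟧))) (sym (lookup-·* ts i _)) (join b a→b)
    ... | no j≢i = subst (λ s → Star (Step X) s _) (sym (Vec.lookup∘update′ j≢i (ts ·* σ) (D ⟦ b ⟧)))
      (star-subst* (star-update σ x (step-respˡ (sym σx≡) (step-context C a→b))) ts j)

  module ReductionOrder (infinite : Infinite V) (_>_ : Rel Term 0ℓ) (ro : IsReductionOrder _>_) where

    open LinearCompletion _>_
    open IsReductionOrder ro
    open IsStrictPartialOrder isStrictPartialOrder using ()
      renaming (asym to >-asym; trans to >-trans; irrefl to >-irrefl)

    -- The system `X` that supplies the critical pairs is kept apart from the rules `R`, because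
    -- fairness speaks of the pairs of `E ω ∪ R ω`.
    Peak : ES → ES → Term → Term → Set
    Peak X R s t = SymClosure (Step (LCP X)) s t ⊎ Joinable R s t

    peak-sym : ∀ {X R s t} → Peak X R s t → Peak X R t s
    peak-sym (inj₁ cp)          = inj₁ (Sym.symmetric _ cp)
    peak-sym (inj₂ (u , s↠ , t↠)) = inj₂ (u , t↠ , s↠)

    peak-context : ∀ {X R s t} C → Peak X R s t → Peak X R (C ⟦ s ⟧) (C ⟦ t ⟧)
    peak-context C (inj₁ cp)          = inj₁ (Sym.gmap (C ⟦_⟧) (step-context C) cp)
    peak-context C (inj₂ (u , s↠ , t↠)) = inj₂ (C ⟦ u ⟧ , star-context C s↠ , star-context C t↠)

    module _ {X R : ES} (R⊆X : R ⊆ X) (R⊆> : R ⊆ uncurry _>_) where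

      -- If the inner redex lies in the value of a variable, the other copies of it are rewritten on
      -- both sides and the outer rule is applied on the left. Otherwise `σ` unifies the inner
      -- left-hand side with a non-variable subterm, and factoring `σ` through the mgu shows the
      -- peak to be an instance of a critical pair.
      overlapPeak : ∀ {ℓ₁ r₁ ℓ₂ r₂} → (ℓ₁ , r₁) ∈ R → (ℓ₂ , r₂) ∈ R → ∀ ρ →
                (∀ {x} → x ∈ₗ varsₑ (ℓ₁ , r₁) → Inverse.to ρ x ∉ₗ varsₑ (ℓ₂ , r₂)) →
                ∀ σ D → ℓ₂ · σ ≡ D ⟦ ℓ₁ · (var ∘ Inverse.to ρ) · σ ⟧ →
                Peak X R (D ⟦ r₁ · (var ∘ Inverse.to ρ) · σ ⟧) (r₂ · σ)
      overlapPeak {ℓ₁} {r₁} {ℓ₂} {r₂} e₁ e₂ ρ apart σ D eq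
        with split R ℓ₂ σ D (ℓ₁ · (var ∘ Inverse.to ρ) · σ) eq
      ... | inj₂ (x , C , σx≡ , join) = inj₂ (r₂ · σ [ x ↦ C ⟦ r₁′ · σ ⟧ ] ,
            join (r₁′ · σ) ℓ₁→r₁ ◅◅ (step e₂ □ _ ◅ ε) ,
            star-subst (star-update σ x (step-respˡ (sym σx≡) (step-context C ℓ₁→r₁))) r₂)
        where
        r₁′ = r₁ · (var ∘ Inverse.to ρ)
        ℓ₁→r₁ : Step R (ℓ₁ · (var ∘ Inverse.to ρ) · σ) (r₁′ · σ)
        ℓ₁→r₁ = step-subst σ (step e₁ □ _)
      ... | inj₁ (p , nv , unif , plug) with mgu-exists (ℓ₁ · (var ∘ Inverse.to ρ)) (ℓ₂ ∣ p) (sym unif)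
      ...   | μ , mgu with proj₂ mgu σ (sym unif)
      ...     | τ , σ≡μτ = inj₁ (fwd (mkStep lcp □ τ (trans (plug r₁′) (factor (ℓ₂ [ r₁′ ]at p))) (factor r₂)))
        where
        ren = var ∘ Inverse.to ρ
        ℓ₁′ = ℓ₁ · ren
        r₁′ = r₁ · ren
        factor : ∀ t → t · σ ≡ t · μ · τ
        factor t = trans (·-cong t λ x _ → σ≡μτ x) (sym (·-assoc t μ τ))
        ℓ₁′>r₁′ : ℓ₁′ > r₁′
        ℓ₁′>r₁′ = closed-subst ren (R⊆> e₁)
        apart′ : ∀ {y} → ¬ (y ∈ₗ varsₑ (ℓ₁′ , r₁′) × y ∈ₗ varsₑ (ℓ₂ , r₂))
        apart′ (y∈₁ , y∈₂) with ∈-map⁻ (Inverse.to ρ) (subst (_ ∈ₗ_)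
          (trans (cong₂ _++_ (vars-rename ℓ₁ _) (vars-rename r₁ _)) (sym (map-++ _ (vars ℓ₁) (vars r₁)))) y∈₁)
        ... | x , x∈ , refl = apart x∈ y∈₂
        -- Both rules are oriented, so asymmetry of `>` yields all the order conditions, before and
        -- after applying `μ`.
        lcp : ((ℓ₂ [ r₁′ ]at p) · μ , r₂ · μ) ∈ LCP X
        lcp = ℓ₁′ , r₁′ , ℓ₂ , r₂ , p , μ , record
          { variant₁    = (ℓ₁ , r₁) , inj₁ (R⊆X e₁) , ρ , refl , refl
          ; variant₂    = (ℓ₂ , r₂) , inj₁ (R⊆X e₂) , ↔-id V , sym (·-identity ℓ₂) , sym (·-identity r₂)
          ; disjoint    = apart′
          ; nonVariable = nv
          ; mgu         = mgu
          ; unordered₁  = >-asym (closed-subst μ ℓ₁′>r₁′)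
          ; unordered₂  = >-asym (closed-subst μ (R⊆> e₂))
          } , inj₁ (ℓ₁′>r₁′ , >-asym (R⊆> e₂)) , refl , refl

      rootPeak : ∀ {ℓ₁ r₁ ℓ₂ r₂} → (ℓ₁ , r₁) ∈ R → (ℓ₂ , r₂) ∈ R → ∀ σ₁ σ₂ D →
                 ℓ₂ · σ₂ ≡ D ⟦ ℓ₁ · σ₁ ⟧ → Peak X R (D ⟦ r₁ · σ₁ ⟧) (r₂ · σ₂)
      rootPeak {ℓ₁} {r₁} {ℓ₂} {r₂} e₁ e₂ σ₁ σ₂ D eq
        with renameApart infinite (varsₑ (ℓ₁ , r₁)) (varsₑ (ℓ₂ , r₂))
      ... | ρ , apart = subst₂ (Peak X R) (cong (D ⟦_⟧) (on₁ r₁ (∈-++⁺ʳ (vars ℓ₁)))) (on₂ r₂ (∈-++⁺ʳ (vars ℓ₂)))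
            (overlapPeak e₁ e₂ ρ apart σ D
              (trans (on₂ ℓ₂ ∈-++⁺ˡ) (trans eq (cong (D ⟦_⟧) (sym (on₁ ℓ₁ ∈-++⁺ˡ))))))
        where
        -- One substitution serves both rules: after renaming, the variables of the first rule avoid
        -- those of the second, and `Inverse.from ρ` recovers the original names.
        σ : Subst
        σ y with em {y ∈ₗ varsₑ (ℓ₂ , r₂)}
        ... | yes _ = σ₂ y
        ... | no  _ = σ₁ (Inverse.from ρ y)
        on₂ : ∀ t → vars t ⊆ₗ varsₑ (ℓ₂ , r₂) → t · σ ≡ t · σ₂
        on₂ t t⊆ = ·-cong t agree
          where
          agree : ∀ y → y ∈ₗ vars t → σ y ≡ σ₂ y
          agree y y∈ with em {y ∈ₗ varsₑ (ℓ₂ , r₂)}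
          ... | yes _ = refl
          ... | no y∉ = contradiction (t⊆ y∈) y∉
        on₁ : ∀ t → vars t ⊆ₗ varsₑ (ℓ₁ , r₁) → t · (var ∘ Inverse.to ρ) · σ ≡ t · σ₁
        on₁ t t⊆ = trans (·-assoc t _ σ) (·-cong t agree)
          where
          agree : ∀ x → x ∈ₗ vars t → σ (Inverse.to ρ x) ≡ σ₁ x
          agree x x∈ with em {Inverse.to ρ x ∈ₗ varsₑ (ℓ₂ , r₂)}
          ... | yes ρx∈ = contradiction ρx∈ (apart (t⊆ x∈))
          ... | no  _   = cong σ₁ (Inverse.strictlyInverseʳ ρ x)

      -- Both contexts are descended while their paths agree. If one of them ends, its redex
      -- contains the other and `rootPeak` applies; if the paths part, the redexes are parallel and
      -- contracting the remaining one on each side closes the peak.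
      contextPeak : ∀ {ℓ₁ r₁ ℓ₂ r₂} → (ℓ₁ , r₁) ∈ R → (ℓ₂ , r₂) ∈ R → ∀ σ₁ σ₂ C D →
                    C ⟦ ℓ₁ · σ₁ ⟧ ≡ D ⟦ ℓ₂ · σ₂ ⟧ → Peak X R (C ⟦ r₁ · σ₁ ⟧) (D ⟦ r₂ · σ₂ ⟧)
      contextPeak e₁ e₂ σ₁ σ₂ □ D eq = peak-sym (rootPeak e₂ e₁ σ₂ σ₁ D eq)
      contextPeak e₁ e₂ σ₁ σ₂ C@(fun _ _ _ _) □ eq = rootPeak e₁ e₂ σ₁ σ₂ C (sym eq)
      contextPeak {ℓ₁} {r₁} {ℓ₂} {r₂} e₁ e₂ σ₁ σ₂ (fun f i us C) (fun g j vs D) eq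
        with fun-injective eq
      ... | refl , eq* with em {i ≡ j}
      ...   | yes refl = subst (λ ws → Peak X R _ (fun f ws)) (sym (rebase (D ⟦ r₂ · σ₂ ⟧)))
              (peak-context (fun f i us □) (contextPeak e₁ e₂ σ₁ σ₂ C D
                (trans (sym (Vec.lookup∘update i us _))
                  (trans (cong (λ ws → lookup ws i) eq*) (Vec.lookup∘update i vs _)))))
        where
        rebase : ∀ s → vs [ i ]≔ s ≡ us [ i ]≔ s
        rebase s = trans ([]≔-overwrite vs _ i s (sym eq*)) (Vec.[]≔-idempotent us i)
      ...   | no i≢j = inj₂ (fun f (us [ i ]≔ s₁ [ j ]≔ s₂) ,
              (step-arg (us [ i ]≔ s₁) j (step-respˡ (sym at-j) (step e₂ D σ₂)) ◅ ε) ,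
              (subst (λ ws → Step R (fun f (vs [ j ]≔ s₂)) (fun f ws)) commute
                (step-arg (vs [ j ]≔ s₂) i (step-respˡ (sym at-i) (step e₁ C σ₁))) ◅ ε))
        where
        s₁ = C ⟦ r₁ · σ₁ ⟧
        s₂ = D ⟦ r₂ · σ₂ ⟧
        at-j : lookup (us [ i ]≔ s₁) j ≡ D ⟦ ℓ₂ · σ₂ ⟧
        at-j = trans (Vec.lookup∘update′ (i≢j ∘ sym) us s₁)
                 (trans (sym (Vec.lookup∘update′ (i≢j ∘ sym) us _))
                   (trans (cong (λ ws → lookup ws j) eq*) (Vec.lookup∘update j vs _)))
        at-i : lookup (vs [ j ]≔ s₂) i ≡ C ⟦ ℓ₁ · σ₁ ⟧
        at-i = trans (Vec.lookup∘update′ i≢j vs s₂)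
                 (trans (sym (Vec.lookup∘update′ i≢j vs _))
                   (trans (cong (λ ws → lookup ws i) (sym eq*)) (Vec.lookup∘update i us _)))
        commute : vs [ j ]≔ s₂ [ i ]≔ s₁ ≡ us [ i ]≔ s₁ [ j ]≔ s₂
        commute = trans (cong (_[ i ]≔ s₁) ([]≔-overwrite vs _ j s₂ (sym eq*)))
          (trans (sym (Vec.[]≔-commutes (us [ i ]≔ _) i j i≢j)) (cong (_[ j ]≔ s₂) (Vec.[]≔-idempotent us i)))

      localPeak : ∀ {u s t} → Step R u s → Step R u t → Peak X R s t
      localPeak u→s u→t = go u→s u→t refl
        where
        -- The sources get separate names joined by an equation, since matching both steps at one
        -- source would require unifying two filled contexts.
        go : ∀ {u v s t} → Step R u s → Step R v t → u ≡ v → Peak X R s t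
        go (step e₁ C σ₁) (step e₂ D σ₂) eq = contextPeak e₁ e₂ σ₁ σ₂ C D eq

    -- Consequences of the axioms of reduction orders.

    ≯-⟦⟧ : ∀ C {t} → ¬ (t > (C ⟦ t ⟧))
    ≯-⟦⟧ C = go (wellFounded _)
      where
      go : ∀ {t} → Acc (flip _>_) t → ¬ (t > (C ⟦ t ⟧))
      -- Closure under contexts turns `t > C ⟦ t ⟧` into the same situation one level down, so the
      -- descent would never end.
      go (acc rs) t>Ct = go (rs t>Ct) (closed-context C t>Ct)

    -- Substituting `s` for a variable of `t` that is missing from `s` fixes `s` and plants a copy
    -- of it in `t`, which `≯-⟦⟧` forbids.
    >⇒vars⊆ : ∀ {s t} → s > t → vars t ⊆ₗ vars s
    >⇒vars⊆ {s} {t} s>t {x} x∈t with em {x ∈ₗ vars s}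
    ... | yes x∈s = x∈s
    ... | no  x∉s with occurrence t (var [ x ↦ s ]) x∈t
    ...   | C , eq = contradiction
      (subst₂ _>_ (·-bind-fresh s s x∉s) (trans eq (cong (C ⟦_⟧) ([↦]-updates var x s)))
              (closed-subst (var [ x ↦ s ]) s>t))
      (≯-⟦⟧ C)

    -- A variable cannot be above a term containing it, by `≯-⟦⟧`; if it does not occur in `t`,
    -- substituting `t` for it gives `t > t`.
    >⇒nonVariable : ∀ {s t} → s > t → NonVariable s
    >⇒nonVariable {s} {t} s>t x refl with em {x ∈ₗ vars t}
    ... | yes x∈t with occurrence t var x∈t
    ...   | C , eq = ≯-⟦⟧ C (subst (s >_) (trans (sym (·-identity t)) eq) s>t)
    >⇒nonVariable {s} {t} s>t x refl | no x∉t = >-irrefl refl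
      (subst₂ _>_ ([↦]-updates var x t) (·-bind-fresh t t x∉t) (closed-subst (var [ x ↦ t ]) s>t))

    ⊆>⇒IsTRS : ∀ {R} → R ⊆ uncurry _>_ → IsTRS R
    ⊆>⇒IsTRS R⊆> ℓ r e = >⇒nonVariable (R⊆> e) , >⇒vars⊆ (R⊆> e)

    step-> : ∀ {R s t} → R ⊆ uncurry _>_ → Step R s t → s > t
    step-> R⊆> (step e C σ) = closed-context C (closed-subst σ (R⊆> e))

    -- `P` is required only at the source of each step. For decreasing steps and a downward closed
    -- `P` the target satisfies it as well.
    ConversionOn : Pred Term 0ℓ → ES → Rel Term 0ℓ
    ConversionOn P X = EqClosure λ s t → Step X s t × P s

    star⇒conversionOn : ∀ {R P s t} → R ⊆ uncurry _>_ → (∀ {s t} → P s → s > t → P t) → P s →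
                        Star (Step R) s t → ConversionOn P R s t
    star⇒conversionOn R⊆> down Ps ε = ε
    star⇒conversionOn R⊆> down Ps (s→u ◅ u↠t) =
      fwd (s→u , Ps) ◅ star⇒conversionOn R⊆> down (down Ps (step-> R⊆> s→u)) u↠t

    conversion-step : ∀ {X Y s t} → X ⊆ uncurry (Conversion Y) → Step X s t → Conversion Y s t
    conversion-step X⊆Y (step e C σ) =
      Eq.gmap (C ⟦_⟧) (step-context C) (Eq.gmap (_· σ) (step-subst σ) (X⊆Y e))

    -- Invariants of runs, and the fate of equations and rules.

    module Run (E R : ℕ → ES) (run : IsRun E R) (R₀-empty : Empty (R zero)) where

      rules⊆> : ∀ i → R i ⊆ uncurry _>_
      rules⊆> zero e = contradiction e (R₀-empty _)
      rules⊆> (suc i) = go (run i) (rules⊆> i)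
        where
        go : ∀ {E R E′ R′} → (E , R) ⊢ₗ (E′ , R′) → R ⊆ uncurry _>_ → R′ ⊆ uncurry _>_
        go (deduce _ _ _ _ (R′⊆ , _)) ih e = ih (R′⊆ e)
        go (orientˡ _ s>t _ _ (R′⊆ , _)) ih e with R′⊆ e
        ... | inj₁ e∈R = ih e∈R
        ... | inj₂ refl = s>t
        go (orientʳ _ t>s _ _ (R′⊆ , _)) ih e with R′⊆ e
        ... | inj₁ e∈R = ih e∈R
        ... | inj₂ refl = t>s
        go (delete _ _ _ (R′⊆ , _)) ih e = ih (R′⊆ e)
        go (compose _ t→u (_ , _ , R∪⊆) _ (R′⊆ , _)) ih e with R′⊆ e
        ... | inj₁ e∈R  = ih (R∪⊆ (inj₁ e∈R))
        -- The old rule gives `s > t`, and rewriting `t` to `u` only decreases it further.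
        ... | inj₂ refl = >-trans (ih (R∪⊆ (inj₂ refl))) (step-> (ih ∘ R∪⊆ ∘ inj₁) t→u)
        go (simplifyˡ _ _ _ _ (R′⊆ , _)) ih e = ih (R′⊆ e)
        go (simplifyʳ _ _ _ _ (R′⊆ , _)) ih e = ih (R′⊆ e)
        go (collapse _ _ _ _ (_ , _ , R∪⊆) _ (R′⊆ , _)) ih e = ih (R∪⊆ (inj₁ (R′⊆ e)))

      R∞⊆> : R ∞ ⊆ uncurry _>_
      R∞⊆> (i , e) = rules⊆> i e

      Rω⊆> : R ω ⊆ uncurry _>_
      Rω⊆> (i , e) = R∞⊆> (i , e i ℕ.≤-refl)

      -- Whatever an inference adds is a conversion by equations and rules already present, so
      -- everything traces back to `E 0`.
      sound : ∀ i → E i ⊆ uncurry (Conversion (E 0)) × R i ⊆ uncurry (Conversion (E 0))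
      sound zero    = (λ e → Eq.return (mkStep e □ var (sym (·-identity _)) (sym (·-identity _)))) ,
                      (λ e → contradiction e (R₀-empty _))
      sound (suc i) = go (run i) (sound i)
        where
        Sound : ES → Set
        Sound X = X ⊆ uncurry (Conversion (E 0))
        sym-conv : ∀ {s t} → Conversion (E 0) s t → Conversion (E 0) t s
        sym-conv = Eq.symmetric _
        extend : ∀ {X Y s t} → Y ⊆ X ∪ ｛ s , t ｝ → Sound X → Conversion (E 0) s t → Sound Y
        extend Y⊆ X-sound s↔t e with Y⊆ e
        ... | inj₁ e∈X = X-sound e∈X
        ... | inj₂ refl = s↔t
        go : ∀ {E R E′ R′} → (E , R) ⊢ₗ (E′ , R′) → Sound E × Sound R → Sound E′ × Sound R′
        go (deduce u→s u→t _ (E′⊆ , _) (R′⊆ , _)) (ihE , ihR) =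
          extend E′⊆ ihE (sym-conv (conversion-step both u→s) ◅◅ conversion-step both u→t) , ihR ∘ R′⊆
          where
          both : Sound (_ ± ∪ _)
          both (inj₁ (inj₁ e)) = ihE e
          both (inj₁ (inj₂ e)) = sym-conv (ihE e)
          both (inj₂ e)        = ihR e
        go (orientˡ _ _ (_ , _ , E∪⊆) (E′⊆ , _) (R′⊆ , _)) (ihE , ihR) =
          ihE ∘ E∪⊆ ∘ inj₁ ∘ E′⊆ , extend R′⊆ ihR (ihE (E∪⊆ (inj₂ refl)))
        go (orientʳ _ _ (_ , _ , E∪⊆) (E′⊆ , _) (R′⊆ , _)) (ihE , ihR) =
          ihE ∘ E∪⊆ ∘ inj₁ ∘ E′⊆ , extend R′⊆ ihR (sym-conv (ihE (E∪⊆ (inj₂ refl))))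
        go (delete _ (_ , _ , E∪⊆) (E′⊆ , _) (R′⊆ , _)) (ihE , ihR) =
          ihE ∘ E∪⊆ ∘ inj₁ ∘ E′⊆ , ihR ∘ R′⊆
        go (compose _ t→u (_ , _ , R∪⊆) (E′⊆ , _) (R′⊆ , _)) (ihE , ihR) =
          ihE ∘ E′⊆ ,
          extend R′⊆ (ihR ∘ R∪⊆ ∘ inj₁) (ihR (R∪⊆ (inj₂ refl)) ◅◅ conversion-step (ihR ∘ R∪⊆ ∘ inj₁) t→u)
        go (simplifyˡ _ s→u (_ , _ , E∪⊆) (E′⊆ , _) (R′⊆ , _)) (ihE , ihR) =
          extend E′⊆ (ihE ∘ E∪⊆ ∘ inj₁) (sym-conv (conversion-step ihR s→u) ◅◅ ihE (E∪⊆ (inj₂ refl))) ,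
          ihR ∘ R′⊆
        go (simplifyʳ _ t→u (_ , _ , E∪⊆) (E′⊆ , _) (R′⊆ , _)) (ihE , ihR) =
          extend E′⊆ (ihE ∘ E∪⊆ ∘ inj₁) (ihE (E∪⊆ (inj₂ refl)) ◅◅ conversion-step ihR t→u) ,
          ihR ∘ R′⊆
        go (collapse _ ℓ→r∈ t→u _ (_ , _ , R∪⊆) (E′⊆ , _) (R′⊆ , _)) (ihE , ihR) =
          extend E′⊆ ihE (sym-conv (conversion-step (λ { refl → ihR (R∪⊆ (inj₁ ℓ→r∈)) }) t→u) ◅◅
                          ihR (R∪⊆ (inj₂ refl))) ,
          ihR ∘ R∪⊆ ∘ inj₁ ∘ R′⊆

      -- An element that is never lost between consecutive stages stays from any stage containing
      -- it. The alternatives may overlap, as a removed element can come back for good.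
      removed⊎persistent : ∀ (X : ℕ → ES) {e} → e ∈ X ∞ → (∃[ k ] e ∈ X k × ¬ (e ∈ X (suc k))) ⊎ e ∈ X ω
      removed⊎persistent X {e} (i , e∈Xᵢ) with em {∃[ k ] e ∈ X k × ¬ (e ∈ X (suc k))}
      ... | yes removed = inj₁ removed
      ... | no never    = inj₂ (i , λ j i≤j → persists (ℕ.≤⇒≤′ i≤j))
        where
        persists : ∀ {j} → i ≤′ j → e ∈ X j
        persists ≤′-refl = e∈Xᵢ
        persists (≤′-step i≤j) with em {e ∈ X (suc _)}
        ... | yes e∈ = e∈
        ... | no e∉  = contradiction (_ , persists i≤j , e∉) never

      -- The ways an inference can remove an equation, with the stage forgotten: the later induction
      -- is on terms, and memberships in the unions are all it needs.
      data EqnFate (s t : Term) : Set where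
        deleted     : s ≡ t → EqnFate s t
        oriented    : (s , t) ∈ R ∞ → EqnFate s t
        reversed    : (t , s) ∈ R ∞ → EqnFate s t
        simplifiedˡ : ∀ {u} → Step (R ∞) s u → (u , t) ∈ E ∞ → EqnFate s t
        simplifiedʳ : ∀ {u} → Step (R ∞) t u → (s , u) ∈ E ∞ → EqnFate s t

      data RuleFate (ℓ r : Term) : Set where
        persistent : (ℓ , r) ∈ R ω → RuleFate ℓ r
        composed   : ∀ {u} → Step (R ∞) r u → (ℓ , u) ∈ R ∞ → RuleFate ℓ r
        collapsed  : ∀ {u ℓ′ r′} → (ℓ′ , r′) ∈ R ∞ → Step ｛ ℓ′ , r′ ｝ ℓ u → ℓ ⊳ ℓ′ →
                     (u , r) ∈ E ∞ → RuleFate ℓ r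

      eqnFate : Empty (E ω) → ∀ {s t} → (s , t) ∈ E ∞ → EqnFate s t
      eqnFate Eω-empty {s} {t} e∈E∞ with removed⊎persistent E e∈E∞
      ... | inj₂ e∈Eω = contradiction e∈Eω (Eω-empty _)
      ... | inj₁ (k , e∈ , e∉) = go (run k) e∈ e∉ refl refl
        where
        go : ∀ {E₁ R₁ E₂ R₂} → (E₁ , R₁) ⊢ₗ (E₂ , R₂) → (s , t) ∈ E₁ → ¬ ((s , t) ∈ E₂) →
             R₁ ≡ R k → (E₂ , R₂) ≡ (E (suc k) , R (suc k)) → EqnFate s t
        go (deduce _ _ _ (_ , ⊇E) _) e∈ e∉ _ _ = contradiction (⊇E (inj₁ e∈)) e∉
        go (orientˡ _ _ (_ , E∪⊇ , _) (_ , ⊇E) (_ , ⊇R)) e∈ e∉ _ refl with E∪⊇ e∈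
        ... | inj₁ e∈E = contradiction (⊇E e∈E) e∉
        ... | inj₂ refl = oriented (suc k , ⊇R (inj₂ refl))
        go (orientʳ _ _ (_ , E∪⊇ , _) (_ , ⊇E) (_ , ⊇R)) e∈ e∉ _ refl with E∪⊇ e∈
        ... | inj₁ e∈E = contradiction (⊇E e∈E) e∉
        ... | inj₂ refl = reversed (suc k , ⊇R (inj₂ refl))
        go (delete _ (_ , E∪⊇ , _) (_ , ⊇E) _) e∈ e∉ _ _ with E∪⊇ e∈
        ... | inj₁ e∈E = contradiction (⊇E e∈E) e∉
        ... | inj₂ refl = deleted refl
        go (compose _ _ _ (_ , ⊇E) _) e∈ e∉ _ _ = contradiction (⊇E e∈) e∉
        go (simplifyˡ _ s→u (_ , E∪⊇ , _) (_ , ⊇E) _) e∈ e∉ refl refl with E∪⊇ e∈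
        ... | inj₁ e∈E = contradiction (⊇E (inj₁ e∈E)) e∉
        ... | inj₂ refl = simplifiedˡ (step-map (k ,_) s→u) (suc k , ⊇E (inj₂ refl))
        go (simplifyʳ _ t→u (_ , E∪⊇ , _) (_ , ⊇E) _) e∈ e∉ refl refl with E∪⊇ e∈
        ... | inj₁ e∈E = contradiction (⊇E (inj₁ e∈E)) e∉
        ... | inj₂ refl = simplifiedʳ (step-map (k ,_) t→u) (suc k , ⊇E (inj₂ refl))
        go (collapse _ _ _ _ _ (_ , ⊇E) _) e∈ e∉ _ _ = contradiction (⊇E (inj₁ e∈)) e∉

      ruleFate : ∀ {ℓ r} → (ℓ , r) ∈ R ∞ → RuleFate ℓ r
      ruleFate {ℓ} {r} e∈R∞ with removed⊎persistent R e∈R∞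
      ... | inj₂ e∈Rω = persistent e∈Rω
      ... | inj₁ (k , e∈ , e∉) = go (run k) e∈ e∉ refl refl
        where
        go : ∀ {E₁ R₁ E₂ R₂} → (E₁ , R₁) ⊢ₗ (E₂ , R₂) → (ℓ , r) ∈ R₁ → ¬ ((ℓ , r) ∈ R₂) →
             R₁ ≡ R k → (E₂ , R₂) ≡ (E (suc k) , R (suc k)) → RuleFate ℓ r
        go (deduce _ _ _ _ (_ , ⊇R)) e∈ e∉ _ _ = contradiction (⊇R e∈) e∉
        go (orientˡ _ _ _ _ (_ , ⊇R)) e∈ e∉ _ _ = contradiction (⊇R (inj₁ e∈)) e∉
        go (orientʳ _ _ _ _ (_ , ⊇R)) e∈ e∉ _ _ = contradiction (⊇R (inj₁ e∈)) e∉
        go (delete _ _ _ (_ , ⊇R)) e∈ e∉ _ _ = contradiction (⊇R e∈) e∉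
        go (compose _ r→u (_ , R∪⊇ , R∪⊆) _ (_ , ⊇R)) e∈ e∉ refl refl with R∪⊇ e∈
        ... | inj₁ e∈R = contradiction (⊇R (inj₁ e∈R)) e∉
        ... | inj₂ refl = composed (step-map (λ e → k , R∪⊆ (inj₁ e)) r→u) (suc k , ⊇R (inj₂ refl))
        go (simplifyˡ _ _ _ _ (_ , ⊇R)) e∈ e∉ _ _ = contradiction (⊇R e∈) e∉
        go (simplifyʳ _ _ _ _ (_ , ⊇R)) e∈ e∉ _ _ = contradiction (⊇R e∈) e∉
        go (collapse _ ℓ′→r′∈ ℓ→u ℓ⊳ℓ′ (_ , R∪⊇ , R∪⊆) (_ , ⊇E) (_ , ⊇R)) e∈ e∉ refl refl with R∪⊇ e∈
        ... | inj₁ e∈R = contradiction (⊇R e∈R) e∉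
        ... | inj₂ refl = collapsed (k , R∪⊆ (inj₁ ℓ′→r′∈)) ℓ→u ℓ⊳ℓ′ (suc k , ⊇E (inj₂ refl))

      -- Turning all steps of the run into conversions by persistent rules.

      module _ (Eω-empty : Empty (E ω)) where

        module _ {P : Pred Term 0ℓ} (down : ∀ {s t} → P s → s > t → P t) where

          Converts : Rel Term 0ℓ
          Converts = ConversionOn P (R ω)

          -- Each simplification lowers one side of the equation and keeps the other, so the
          -- recursion is on the accessibility of both. `Q` bounds where `rules` is available: it is
          -- `P` itself for `E∞-converts`, but only the terms below the source when a rule
          -- collapses.
          eqn-converts : ∀ {Q : Pred Term 0ℓ} → (∀ {s t} → Q s → s > t → Q t) →
                         (∀ {s t} → Q s → Step (R ∞) s t → Converts s t) →
                         ∀ {s t} C σ → (s , t) ∈ E ∞ →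
                         Acc (flip _>_) (C ⟦ s · σ ⟧) → Acc (flip _>_) (C ⟦ t · σ ⟧) →
                         Q (C ⟦ s · σ ⟧) → Q (C ⟦ t · σ ⟧) → Converts (C ⟦ s · σ ⟧) (C ⟦ t · σ ⟧)
          eqn-converts {Q} Q-down rules {s} {t} C σ e (acc rs) (acc rt) Qs Qt with eqnFate Eω-empty e
          ... | deleted refl = ε
          ... | oriented e′  = rules Qs (step e′ C σ)
          ... | reversed e′  = Eq.symmetric _ (rules Qt (step e′ C σ))
          ... | simplifiedˡ s→u e′ = rules Qs Cs→Cu ◅◅
                eqn-converts Q-down rules C σ e′ (rs (step-> R∞⊆> Cs→Cu)) (acc rt)
                  (Q-down Qs (step-> R∞⊆> Cs→Cu)) Qt
            where Cs→Cu = step-context C (step-subst σ s→u)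
          ... | simplifiedʳ t→u e′ =
                eqn-converts Q-down rules C σ e′ (acc rs) (rt (step-> R∞⊆> Ct→Cu))
                  Qs (Q-down Qt (step-> R∞⊆> Ct→Cu)) ◅◅
                Eq.symmetric _ (rules Qt Ct→Cu)
            where Ct→Cu = step-context C (step-subst σ t→u)

          -- `below` is the induction hypothesis for smaller sources. Composition keeps the
          -- left-hand side, lowers the right-hand side, and leaves a correcting step that starts
          -- below `s`. Collapse passes at the same source to a properly encompassed left-hand side
          -- and leaves an equation with both ends below `s`.
          rule-converts : ∀ {ℓ r s t} → (∀ {v w} → s > v → Step (R ∞) v w → Converts v w) →
                          Acc (flip _⊳_) ℓ → Acc (flip _>_) r →
                          (ℓ , r) ∈ R ∞ → Step ｛ ℓ , r ｝ s t → P s → Converts s t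
          rule-converts {ℓ} {r} below (acc rℓ) (acc rr) e (step refl C σ) Ps with ruleFate e
          ... | persistent e′ = Eq.return (step e′ C σ , Ps)
          ... | composed r→u e′ =
                rule-converts below (acc rℓ) (rr (step-> R∞⊆> r→u)) e′ (step refl C σ) Ps ◅◅
                Eq.symmetric _ (below (step-> R∞⊆> (step e C σ)) (step-context C (step-subst σ r→u)))
          ... | collapsed e′ ℓ→u ℓ⊳ℓ′ e″ =
                -- The new rule has an unrelated right-hand side, so its accessibility starts
                -- afresh; the left-hand side has dropped.
                rule-converts below (rℓ ℓ⊳ℓ′) (wellFounded _) e′ Cℓ→Cu Ps ◅◅
                eqn-converts {Q = (C ⟦ ℓ · σ ⟧) >_} >-trans below C σ e″ (wellFounded _) (wellFounded _)
                  (step-> (λ { refl → R∞⊆> e′ }) Cℓ→Cu) (step-> R∞⊆> (step e C σ))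
            where Cℓ→Cu = step-context C (step-subst σ ℓ→u)

          R∞-converts : ∀ {s t} → Acc (flip _>_) s → P s → Step (R ∞) s t → Converts s t
          R∞-converts (acc rs) Ps (step e C σ) =
            rule-converts (λ s>v → R∞-converts (rs s>v) (down Ps s>v))
              (⊳-wellFounded _) (wellFounded _) e (step refl C σ) Ps

          E∞-converts : ∀ {s t} → Step (E ∞) s t → P s → P t → Converts s t
          E∞-converts (step e C σ) =
            eqn-converts {Q = P} down (R∞-converts (wellFounded _)) C σ e (wellFounded _) (wellFounded _)

        peak-connected : Fair E R → ∀ {u s t} → Step (R ω) u s → Step (R ω) u t →
                         ConversionOn (u >_) (R ω) s t
        peak-connected fair {u} u→s u→t = connect (step-> Rω⊆> u→s) (step-> Rω⊆> u→t) (localPeak inj₂ Rω⊆> u→s u→t)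
          where
          joined : ∀ {s t} → u > s → u > t → Joinable (R ω) s t → ConversionOn (u >_) (R ω) s t
          joined u>s u>t (v , s↠v , t↠v) =
            star⇒conversionOn Rω⊆> >-trans u>s s↠v ◅◅
            Eq.symmetric _ (star⇒conversionOn Rω⊆> >-trans u>t t↠v)
          critical : ∀ {s t} → u > s → u > t → Step (LCP (E ω ∪ R ω)) s t → ConversionOn (u >_) (R ω) s t
          -- Fairness concerns the bare critical pair; its valley or its equation step is carried
          -- into `C` and `σ`, where both ends are below `u`.
          critical u>s u>t (step cp C σ) with fair cp
          ... | inj₁ (v , s↠v , t↠v) = joined u>s u>t
                (C ⟦ v · σ ⟧ , star-context C (Star.gmap (_· σ) (step-subst σ) s↠v) ,
                               star-context C (Star.gmap (_· σ) (step-subst σ) t↠v))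
          ... | inj₂ (fwd s→t) = E∞-converts >-trans (step-context C (step-subst σ s→t)) u>s u>t
          ... | inj₂ (bwd t→s) = Eq.symmetric _
                (E∞-converts >-trans (step-context C (step-subst σ t→s)) u>t u>s)
          connect : ∀ {s t} → u > s → u > t → Peak (E ω ∪ R ω) (R ω) s t → ConversionOn (u >_) (R ω) s t
          connect u>s u>t (inj₁ (fwd cp)) = critical u>s u>t cp
          connect u>s u>t (inj₁ (bwd cp)) = Eq.symmetric _ (critical u>t u>s cp)
          connect u>s u>t (inj₂ j)        = joined u>s u>t j

        completePresentation : Fair E R → CompletePresentation (R ω) (E zero)
        completePresentation fair = record
          { isTRS      = ⊆>⇒IsTRS Rω⊆>
          ; complete   = record
            { terminating = Subrelation.wellFounded (step-> Rω⊆>) wellFounded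
            ; confluent   = connectedBelow⇒confluent >-trans wellFounded (step-> Rω⊆>) (peak-connected fair)
            }
          ; conversion =
              (conversion-step (λ (i , e) → proj₂ (sound i) (e i ℕ.≤-refl))) Eq.⋆ ,
              -- Steps of `E 0` are steps of `E ∞`; with the trivial predicate the bound is vacuous
              -- and is then forgotten.
              (λ s→t → Eq.map proj₁ (E∞-converts {P = λ _ → ⊤} _ (step-map (zero ,_) s→t) _ _)) Eq.⋆
          }

theorem8p17 : ExcludedMiddle 0ℓ →
    (𝓕 : Signature) (V : Set) → Infinite V →
    let open TermRewriting 𝓕 V in
    (_>_ : Rel Term 0ℓ) → IsReductionOrder _>_ →
    let open LinearCompletion _>_ in
    (E R : ℕ → ES) → IsRun E R →
    Empty (R zero) → LinearES (E zero) →
    Fair E R → Empty (E ω) →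
    CompletePresentation (R ω) (E zero)
theorem8p17 em 𝓕 V infinite _>_ ro E R run R₀-empty _ fair Eω-empty =
  Classical.ReductionOrder.Run.completePresentation em 𝓕 V infinite _>_ ro E R run R₀-empty Eω-empty fair
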